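{- For every integer $k\ge 0$, $$\frac{\pi}{4}=2\arctan\left(\frac{1}{\phi^{2k}}\right)+\arctan\left(\frac{ -2+(L_{2k}-2)\phi^{2k}}{ -2+(L_{2k}+2)\phi^{2k}}\right).$$
   Context: $\phi=\frac{1+\sqrt5}{2}$ is the Golden mean. $(L_m)_{m\ge0}$ is the sequence of Lucas numbers: $L_0=2$, $L_1=1$, $L_m=L_{m-1}+L_{m-2}$ for $m\ge2$. -}

module Defs where

open import Level using (_⊔_) renaming (suc to lsuc)
open import Data.Empty using (⊥; ⊥-elim)
open import Data.Maybe.Base using (Maybe; just; nothing)
open import Data.Nat.Base as ℕ using (ℕ; zero; suc; NonZero; _!; z≤n; s≤s)
import Data.Nat.Properties as ℕ
open import Data.Product.Base using (∃; _×_; _,_; proj₁; proj₂; Σ-syntax)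
open import Data.Sum.Base using (_⊎_; inj₁; inj₂)
open import Relation.Binary.Core using (Rel)
open import Relation.Binary.Structures using (IsStrictPartialOrder)
open import Relation.Binary.PropositionalEquality.Core as ≡ using (_≡_)
open import Relation.Nullary using (yes; no)
open import Algebra.Bundles using (CommutativeRing; RawRing; Semiring)
open import Algebra.Apartness.Bundles using (HeytingField)
import Algebra.Definitions.RawSemiring as RawSemiringDefs
import Algebra.Properties.Semiring.Mult as SemiringMult
import Algebra.Properties.Ring as RingProperties
import Algebra.Apartness.Properties.HeytingCommutativeRing as HeytingProperties
open import Algebra.Solver.Ring.AlmostCommutativeRing
  using (AlmostCommutativeRing; fromCommutativeRing; _-Raw-AlmostCommutative⟶_)
import Algebra.Solver.Ring
import Relation.Binary.Reasoning.Setoid as SetoidReasoning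

L : ℕ → ℕ
L 0             = 2
L 1             = 1
L (suc (suc m)) = L (suc m) ℕ.+ L m

-- The real numbers, given by their constructive axioms: a Cauchy-complete
-- Archimedean ordered field.  These axioms determine ℝ up to isomorphism.
-- The order is strict; x ≤ y is ¬ (y < x).
record RealNumbers c ℓ₁ ℓ₂ ℓ₃ : Set (lsuc (c ⊔ ℓ₁ ⊔ ℓ₂ ⊔ ℓ₃)) where
  infix 4 _<_ _⟶_
  field
    heytingField : HeytingField c ℓ₁ ℓ₂

  open HeytingField heytingField public renaming (zero to *-zero)

  commutativeRing : CommutativeRing c ℓ₁
  commutativeRing = record { isCommutativeRing = isCommutativeRing }

  open RawSemiringDefs (Semiring.rawSemiring (CommutativeRing.semiring commutativeRing)) public
    using (_^_) renaming (_×_ to _·_)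

  fromℕ : ℕ → Carrier
  fromℕ n = n · 1#

  field
    _<_                  : Rel Carrier ℓ₃
    isStrictPartialOrder : IsStrictPartialOrder _≈_ _<_
    <⇒#                  : ∀ {x y} → x < y → x # y
    #⇒<⊎>                : ∀ {x y} → x # y → x < y ⊎ y < x
    +-monoˡ-<            : ∀ {x y} z → x < y → x + z < y + z
    *-pos                : ∀ {x y} → 0# < x → 0# < y → 0# < x * y
    archimedean          : ∀ x → ∃ λ n → x < fromℕ n

  -- |x - y| < ε
  Within : Carrier → Carrier → Carrier → Set ℓ₃
  Within ε x y = x - y < ε × y - x < ε

  IsCauchy : (ℕ → Carrier) → Set (c ⊔ ℓ₃)
  IsCauchy u = ∀ ε → 0# < ε →
    ∃ λ N → ∀ m n → N ℕ.≤ m → N ℕ.≤ n → Within ε (u m) (u n)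

  _⟶_ : (ℕ → Carrier) → Carrier → Set (c ⊔ ℓ₃)
  u ⟶ l = ∀ ε → 0# < ε → ∃ λ N → ∀ n → N ℕ.≤ n → Within ε (u n) l

  field
    complete : ∀ u → IsCauchy u → ∃ λ l → u ⟶ l

private
  power≤factorial : ∀ K .{{_ : NonZero K}} m → K ℕ.^ m ℕ.≤ K ℕ.^ K ℕ.* m !
  power≤factorial K zero = ℕ.*-mono-≤ {1} (ℕ.m^n>0 K K) (ℕ.≤-refl {1})
  power≤factorial K (suc m) with suc m ℕ.≤? K
  ... | yes sm≤K = ℕ.≤-trans (ℕ.^-monoʳ-≤ K sm≤K)
          (ℕ.m≤m*n (K ℕ.^ K) (suc m !) {{(suc m) ℕ.!≢0}})
  ... | no  sm≰K = begin
          K ℕ.* K ℕ.^ m               ≤⟨ ℕ.*-mono-≤ (ℕ.<⇒≤ (ℕ.≰⇒> sm≰K)) (power≤factorial K m) ⟩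
          suc m ℕ.* (K ℕ.^ K ℕ.* m !) ≡⟨ ℕ.*-assoc (suc m) (K ℕ.^ K) (m !) ⟨
          suc m ℕ.* K ℕ.^ K ℕ.* m !   ≡⟨ ≡.cong (ℕ._* m !) (ℕ.*-comm (suc m) (K ℕ.^ K)) ⟩
          K ℕ.^ K ℕ.* suc m ℕ.* m !   ≡⟨ ℕ.*-assoc (K ℕ.^ K) (suc m) (m !) ⟩
          K ℕ.^ K ℕ.* suc m !         ∎
    where open ℕ.≤-Reasoning

module RealAnalysis {c ℓ₁ ℓ₂ ℓ₃} (R : RealNumbers c ℓ₁ ℓ₂ ℓ₃) where

  open RealNumbers R
  open CommutativeRing commutativeRing using (ring; semiring)
  open RingProperties ring using (-‿distribˡ-*; -‿distribʳ-*; -‿involutive)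
  open SemiringMult semiring using (×-homo-+; ×1-homo-*)
  open HeytingProperties (HeytingField.heytingCommutativeRing heytingField)
    using (1#0; x-0≈x)
  open IsStrictPartialOrder isStrictPartialOrder using (<-respʳ-≈; <-respˡ-≈)
    renaming (irrefl to <-irrefl; trans to <-trans)
  open SetoidReasoning setoid

  -- A ring solver with integer coefficients.  A pair (a , b) stands for the
  -- integer a - b; con (n , 0) denotes fromℕ n, except that con (1 , 0) is 1#.

  private
    ⟦_⟧ℕ : ℕ → Carrier
    ⟦ 0 ⟧ℕ = 0#
    ⟦ 1 ⟧ℕ = 1#
    ⟦ suc (suc n) ⟧ℕ = fromℕ (suc (suc n))

    ⟦⟧ℕ≈ : ∀ n → ⟦ n ⟧ℕ ≈ fromℕ n
    ⟦⟧ℕ≈ 0 = refl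
    ⟦⟧ℕ≈ 1 = sym (+-identityʳ 1#)
    ⟦⟧ℕ≈ (suc (suc n)) = refl

    ⟦_⟧ : ℕ × ℕ → Carrier
    ⟦ a , zero ⟧ = ⟦ a ⟧ℕ
    ⟦ a , suc b ⟧ = fromℕ a - fromℕ (suc b)

    ⟦⟧≈ : ∀ a b → ⟦ a , b ⟧ ≈ fromℕ a - fromℕ b
    ⟦⟧≈ a zero = trans (⟦⟧ℕ≈ a) (sym (x-0≈x (fromℕ a)))
    ⟦⟧≈ a (suc b) = refl

    rearr : ∀ w x y z → (w + x) + (y + z) ≈ (w + y) + (x + z)
    rearr w x y z = begin
      (w + x) + (y + z) ≈⟨ +-assoc w x (y + z) ⟩
      w + (x + (y + z)) ≈⟨ +-congˡ (+-assoc x y z) ⟨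
      w + ((x + y) + z) ≈⟨ +-congˡ (+-congʳ (+-comm x y)) ⟩
      w + ((y + x) + z) ≈⟨ +-congˡ (+-assoc y x z) ⟩
      w + (y + (x + z)) ≈⟨ +-assoc w y (x + z) ⟨
      (w + y) + (x + z) ∎

    neg-+ : ∀ x y → - (x + y) ≈ - x + - y
    neg-+ x y = sym (AlmostCommutativeRing.-‿+-comm (fromCommutativeRing commutativeRing) x y)

    cancel : ∀ {w x y z} → w + z ≈ y + x → w - x ≈ y - z
    cancel {w} {x} {y} {z} e = begin
      w - x                 ≈⟨ +-identityʳ _ ⟨
      (w - x) + 0#          ≈⟨ +-congˡ (-‿inverseʳ z) ⟨
      (w - x) + (z - z)     ≈⟨ rearr w (- x) z (- z) ⟩
      (w + z) + (- x - z)   ≈⟨ +-congʳ e ⟩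
      (y + x) + (- x - z)   ≈⟨ +-congˡ (+-comm (- x) (- z)) ⟩
      (y + x) + (- z - x)   ≈⟨ rearr y x (- z) (- x) ⟩
      (y - z) + (x - x)     ≈⟨ +-congˡ (-‿inverseʳ x) ⟩
      (y - z) + 0#          ≈⟨ +-identityʳ _ ⟩
      y - z ∎

    normalise : ℕ → ℕ → ℕ × ℕ
    normalise zero    b       = zero , b
    normalise (suc a) zero    = suc a , zero
    normalise (suc a) (suc b) = normalise a b

    ⟦normalise⟧≈ : ∀ a b → ⟦ normalise a b ⟧ ≈ fromℕ a - fromℕ b
    ⟦normalise⟧≈ zero    b       = ⟦⟧≈ zero b
    ⟦normalise⟧≈ (suc a) zero    = ⟦⟧≈ (suc a) zero
    ⟦normalise⟧≈ (suc a) (suc b) = trans (⟦normalise⟧≈ a b) (cancel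
      (begin
      fromℕ a + (1# + fromℕ b) ≈⟨ +-assoc _ _ _ ⟨
      (fromℕ a + 1#) + fromℕ b ≈⟨ +-congʳ (+-comm _ _) ⟩
      (1# + fromℕ a) + fromℕ b ∎))

    coeffs : RawRing _ _
    coeffs = record
      { Carrier = ℕ × ℕ
      ; _≈_ = _≡_
      ; _+_ = λ (a , b) (a′ , b′) → normalise (a ℕ.+ a′) (b ℕ.+ b′)
      ; _*_ = λ (a , b) (a′ , b′) →
                normalise (a ℕ.* a′ ℕ.+ b ℕ.* b′) (a ℕ.* b′ ℕ.+ b ℕ.* a′)
      ; -_ = λ (a , b) → b , a
      ; 0# = 0 , 0
      ; 1# = 1 , 0
      }

    morphism : coeffs -Raw-AlmostCommutative⟶ fromCommutativeRing commutativeRing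
    morphism = record
      { ⟦_⟧ = ⟦_⟧
      ; +-homo = λ (a , b) (a′ , b′) → begin
          ⟦ normalise (a ℕ.+ a′) (b ℕ.+ b′) ⟧  ≈⟨ ⟦normalise⟧≈ (a ℕ.+ a′) (b ℕ.+ b′) ⟩
          fromℕ (a ℕ.+ a′) - fromℕ (b ℕ.+ b′)
            ≈⟨ +-cong (×-homo-+ 1# a a′) (-‿cong (×-homo-+ 1# b b′)) ⟩
          (fromℕ a + fromℕ a′) - (fromℕ b + fromℕ b′) ≈⟨ +-congˡ (neg-+ _ _) ⟩
          (fromℕ a + fromℕ a′) + (- fromℕ b + - fromℕ b′) ≈⟨ rearr _ _ _ _ ⟩
          (fromℕ a - fromℕ b) + (fromℕ a′ - fromℕ b′)
            ≈⟨ +-cong (⟦⟧≈ a b) (⟦⟧≈ a′ b′) ⟨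
          ⟦ a , b ⟧ + ⟦ a′ , b′ ⟧ ∎
      ; *-homo = λ (a , b) (a′ , b′) →
          let A = fromℕ a ; B = fromℕ b ; A′ = fromℕ a′ ; B′ = fromℕ b′ in begin
          ⟦ normalise (a ℕ.* a′ ℕ.+ b ℕ.* b′) (a ℕ.* b′ ℕ.+ b ℕ.* a′) ⟧
            ≈⟨ ⟦normalise⟧≈ (a ℕ.* a′ ℕ.+ b ℕ.* b′) (a ℕ.* b′ ℕ.+ b ℕ.* a′) ⟩
          fromℕ (a ℕ.* a′ ℕ.+ b ℕ.* b′) - fromℕ (a ℕ.* b′ ℕ.+ b ℕ.* a′)
            ≈⟨ +-cong (homo a a′ b b′) (-‿cong (homo a b′ b a′)) ⟩
          (A * A′ + B * B′) - (A * B′ + B * A′)    ≈⟨ +-congˡ (neg-+ _ _) ⟩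
          (A * A′ + B * B′) + (- (A * B′) + - (B * A′))
            ≈⟨ rearr _ _ _ _ ⟩
          (A * A′ + - (A * B′)) + (B * B′ + - (B * A′))
            ≈⟨ +-cong
                 (trans (+-congˡ (-‿distribʳ-* A B′)) (sym (distribˡ A A′ (- B′))))
                 (begin
                   B * B′ + - (B * A′)       ≈⟨ +-comm _ _ ⟩
                   - (B * A′) + B * B′       ≈⟨ +-cong (-‿distribˡ-* B A′) (lem B B′) ⟩
                   (- B) * A′ + (- B) * (- B′) ≈⟨ distribˡ (- B) A′ (- B′) ⟨
                   (- B) * (A′ - B′) ∎) ⟩
          A * (A′ - B′) + (- B) * (A′ - B′)        ≈⟨ distribʳ (A′ - B′) A (- B) ⟨
          (A - B) * (A′ - B′)     ≈⟨ *-cong (⟦⟧≈ a b) (⟦⟧≈ a′ b′) ⟨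
          ⟦ a , b ⟧ * ⟦ a′ , b′ ⟧ ∎
      ; -‿homo = λ (a , b) → begin
          ⟦ b , a ⟧                   ≈⟨ ⟦⟧≈ b a ⟩
          fromℕ b - fromℕ a           ≈⟨ +-comm _ _ ⟩
          - fromℕ a + fromℕ b         ≈⟨ +-congˡ (-‿involutive (fromℕ b)) ⟨
          - fromℕ a + - (- fromℕ b)   ≈⟨ neg-+ _ _ ⟨
          - (fromℕ a - fromℕ b)       ≈⟨ -‿cong (⟦⟧≈ a b) ⟨
          - ⟦ a , b ⟧ ∎
      ; 0-homo = refl
      ; 1-homo = refl
      }
      where
      lem : ∀ x y → x * y ≈ (- x) * (- y)
      lem x y = begin
        x * y           ≈⟨ -‿involutive (x * y) ⟨
        - (- (x * y))   ≈⟨ -‿cong (-‿distribˡ-* x y) ⟩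
        - ((- x) * y)   ≈⟨ -‿distribʳ-* (- x) y ⟩
        (- x) * (- y)   ∎
      homo : ∀ a a′ b b′ → fromℕ (a ℕ.* a′ ℕ.+ b ℕ.* b′)
                         ≈ fromℕ a * fromℕ a′ + fromℕ b * fromℕ b′
      homo a a′ b b′ = trans (×-homo-+ 1# (a ℕ.* a′) (b ℕ.* b′))
                             (+-cong (×1-homo-* a a′) (×1-homo-* b b′))

    decide : ∀ p q → Maybe (⟦ p ⟧ ≈ ⟦ q ⟧)
    decide (a , b) (a′ , b′) with a ℕ.+ b′ ℕ.≟ a′ ℕ.+ b
    ... | no _  = nothing
    ... | yes e = just (trans (⟦⟧≈ a b) (trans (cancel (begin
      fromℕ a + fromℕ b′     ≈⟨ ×-homo-+ 1# a b′ ⟨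
      fromℕ (a ℕ.+ b′)       ≈⟨ reflexive (≡.cong fromℕ e) ⟩
      fromℕ (a′ ℕ.+ b)       ≈⟨ ×-homo-+ 1# a′ b ⟩
      fromℕ a′ + fromℕ b     ∎)) (sym (⟦⟧≈ a′ b′))))

  module Solver =
    Algebra.Solver.Ring coeffs (fromCommutativeRing commutativeRing) morphism decide
  open Solver using (solve; con; _:=_; _:+_; _:*_; _:-_; :-_)

  0<y-x : ∀ {x y} → x < y → 0# < y - x
  0<y-x {x} {y} x<y = <-respˡ-≈ (-‿inverseʳ x) (+-monoˡ-< (- x) x<y)

  -- Inequalities are proved by exhibiting y - x as a positive expression.
  <-from : ∀ {x y p} → 0# < p → y - x ≈ p → x < y
  <-from {x} {y} {p} 0<p e =
    <-respˡ-≈ (+-identityˡ x) (<-respʳ-≈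
      (solve 2 (λ x y → (y :- x) :+ x := y) refl x y)
      (+-monoˡ-< x (<-respʳ-≈ (sym e) 0<p)))

  +-pos : ∀ {x y} → 0# < x → 0# < y → 0# < x + y
  +-pos {x} {y} 0<x 0<y =
    <-trans 0<y (<-respˡ-≈ (+-identityˡ y) (+-monoˡ-< y 0<x))

  0<1 : 0# < 1#
  0<1 with #⇒<⊎> 1#0
  ... | inj₂ 0<1 = 0<1
  ... | inj₁ 1<0 = <-respʳ-≈
          (solve 0 ((con (0 , 0) :- con (1 , 0)) :* (con (0 , 0) :- con (1 , 0)) := con (1 , 0)) refl)
          (*-pos (0<y-x 1<0) (0<y-x 1<0))

  0<fromℕ : ∀ n → 0# < fromℕ (suc n)
  0<fromℕ zero    = <-respʳ-≈ (sym (+-identityʳ 1#)) 0<1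
  0<fromℕ (suc n) = +-pos 0<1 (0<fromℕ n)

  pos⇒#0 : ∀ {x} → 0# < x → x # 0#
  pos⇒#0 0<x = #-sym (<⇒# 0<x)

  inv : ∀ x → x # 0# → Carrier
  inv x x#0 = proj₁ (#⇒invertible x#0)

  inv-inverseʳ : ∀ x (x#0 : x # 0#) → x * inv x x#0 ≈ 1#
  inv-inverseʳ x x#0 =
    trans (*-congʳ (sym (x-0≈x x))) (proj₂ (proj₂ (#⇒invertible x#0)))

  infixl 7 _/_[_] _/ℕ_

  _/_[_] : ∀ x y → y # 0# → Carrier
  x / y [ y#0 ] = x * inv y y#0

  _/ℕ_ : Carrier → (n : ℕ) → .{{NonZero n}} → Carrier
  x /ℕ suc n = x / fromℕ (suc n) [ pos⇒#0 (0<fromℕ n) ]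

  inv-pos : ∀ {x} (x#0 : x # 0#) → 0# < x → 0# < inv x x#0
  inv-pos {x} x#0 0<x with #⇒<⊎> i#0
    where
    i = inv x x#0
    i#0 : i # 0#
    i#0 = invertible⇒# (x , trans (*-congˡ (x-0≈x i)) (inv-inverseʳ x x#0)
                          , trans (*-congʳ (x-0≈x i)) (trans (*-comm i x) (inv-inverseʳ x x#0)))
  ... | inj₂ 0<i = 0<i
  ... | inj₁ i<0 = ⊥-elim (<-irrefl refl (<-respʳ-≈
          (begin
            x * (0# - i) + 1#  ≈⟨ +-congˡ (inv-inverseʳ x x#0) ⟨
            x * (0# - i) + x * i ≈⟨ solve 2 (λ x i → x :* (con (0 , 0) :- i) :+ x :* i := con (0 , 0)) refl x i ⟩
            0# ∎)
          (+-pos (*-pos 0<x (0<y-x i<0)) 0<1)))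
    where i = inv x x#0

  /ℕ-pos : ∀ {x} n .{{_ : NonZero n}} → 0# < x → 0# < x /ℕ n
  /ℕ-pos (suc n) 0<x = *-pos 0<x (inv-pos _ (0<fromℕ n))

  *-/ℕ : ∀ x n .{{_ : NonZero n}} → fromℕ n * (x /ℕ n) ≈ x
  *-/ℕ x (suc n) = begin
    fromℕ (suc n) * (x * i) ≈⟨ solve 3 (λ n x i → n :* (x :* i) := x :* (n :* i)) refl (fromℕ (suc n)) x i ⟩
    x * (fromℕ (suc n) * i) ≈⟨ *-congˡ (inv-inverseʳ _ _) ⟩
    x * 1#                  ≈⟨ *-identityʳ x ⟩
    x ∎
    where i = inv (fromℕ (suc n)) (pos⇒#0 (0<fromℕ n))

  h : Carrier
  h = 1# /ℕ 2

  0<h : 0# < h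
  0<h = /ℕ-pos 2 0<1

  h+h≈1 : h + h ≈ 1#
  h+h≈1 = trans (solve 1 (λ h → h :+ h := con (2 , 0) :* h) refl h) (*-/ℕ 1# 2)

  0<h^ : ∀ n → 0# < h ^ n
  0<h^ zero    = 0<1
  0<h^ (suc n) = *-pos 0<h (0<h^ n)

  -- Ring identities modulo a relation s ≈ 1, for use with the solver.
  modulo : ∀ {a b s} t → s ≈ 1# → a ≈ b + t * (s - 1#) → a ≈ b
  modulo {a} {b} {s} t e p = begin
    a                  ≈⟨ p ⟩
    b + t * (s - 1#)   ≈⟨ +-congˡ (*-congˡ (+-congʳ e)) ⟩
    b + t * (1# - 1#)  ≈⟨ solve 2 (λ b t → b :+ t :* (con (1 , 0) :- con (1 , 0)) := b) refl b t ⟩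
    b ∎

  -- |x| < a
  Bounded : Carrier → Carrier → Set ℓ₃
  Bounded x a = x < a × - x < a

  Bounded-resp : ∀ {x y a b} → x ≈ y → a ≈ b → Bounded x a → Bounded y b
  Bounded-resp x≈y a≈b (p , q) =
    <-respˡ-≈ x≈y (<-respʳ-≈ a≈b p) , <-respˡ-≈ (-‿cong x≈y) (<-respʳ-≈ a≈b q)

  Bounded-neg : ∀ {x a} → Bounded x a → Bounded (- x) a
  Bounded-neg {x} (p , q) = q , <-respˡ-≈ (sym (-‿involutive x)) p

  bound-pos : ∀ {x a} → Bounded x a → 0# < a
  bound-pos {x} {a} (p , q) = <-respʳ-≈
    (modulo a h+h≈1 (solve 3 (λ x a h →
      h :* ((a :- x) :+ (a :- (:- x))) := a :+ a :* (h :+ h :- con (1 , 0))) refl x a h))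
    (*-pos 0<h (+-pos (0<y-x p) (0<y-x q)))

  Bounded-* : ∀ {x y a b} → Bounded x a → Bounded y b → Bounded (x * y) (a * b)
  Bounded-* {x} {y} {a} {b} (p , p′) (q , q′) =
      <-from (*-pos 0<h (+-pos (*-pos (0<y-x p) (0<y-x q′)) (*-pos (0<y-x p′) (0<y-x q))))
        (sym (modulo (a * b - x * y) h+h≈1 (solve 5 (λ x y a b h →
          h :* ((a :- x) :* (b :- (:- y)) :+ (a :- (:- x)) :* (b :- y))
            := (a :* b :- x :* y) :+ (a :* b :- x :* y) :* (h :+ h :- con (1 , 0))) refl x y a b h)))
    , <-from (*-pos 0<h (+-pos (*-pos (0<y-x p) (0<y-x q)) (*-pos (0<y-x p′) (0<y-x q′))))
        (sym (modulo (a * b - - (x * y)) h+h≈1 (solve 5 (λ x y a b h →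
          h :* ((a :- x) :* (b :- y) :+ (a :- (:- x)) :* (b :- (:- y)))
            := (a :* b :- (:- (x :* y))) :+ (a :* b :- (:- (x :* y))) :* (h :+ h :- con (1 , 0))) refl x y a b h)))

  n*h^n : ∀ n → h ^ n < fromℕ 2 × fromℕ (suc n) * h ^ n < fromℕ 2
  n*h^n zero =
      <-from 0<1 (solve 0 (con (2 , 0) :- con (1 , 0) := con (1 , 0)) refl)
    , <-from 0<1 (solve 0 (con (2 , 0) :- (con (1 , 0) :+ con (0 , 0)) :* con (1 , 0) := con (1 , 0)) refl)
  n*h^n (suc n) with n*h^n n
  ... | p , q =
      <-from (+-pos (*-pos 0<h (0<y-x p)) 0<1)
        (modulo (- 1#) h+h≈1 (solve 2 (λ h x →
          con (2 , 0) :- h :* x := (h :* (con (2 , 0) :- x) :+ con (1 , 0))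
            :+ (:- con (1 , 0)) :* (h :+ h :- con (1 , 0))) refl h (h ^ n)))
    , <-from (+-pos (*-pos 0<h (0<y-x p)) (*-pos 0<h (0<y-x q)))
        (modulo (- fromℕ 2) h+h≈1 (solve 3 (λ h x k →
          con (2 , 0) :- (con (1 , 0) :+ k) :* (h :* x)
            := (h :* (con (2 , 0) :- x) :+ h :* (con (2 , 0) :- k :* x))
            :+ (:- con (2 , 0)) :* (h :+ h :- con (1 , 0))) refl h (h ^ n) (fromℕ (suc n))))

  -- The intervals [ u n - 2C / 2ⁿ , u n + 2C / 2ⁿ ] are nested.
  geometric-cauchy : ∀ u C → (∀ n → Bounded (u (suc n) - u n) (C * h ^ n)) → IsCauchy u
  geometric-cauchy u C bounded ε 0<ε =
    N , λ m n N≤m N≤n → within m n N≤m N≤n , within n m N≤n N≤m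
    where
    q T U : ℕ → Carrier
    q n = C * h ^ n
    T n = u n + (q n + q n)
    U n = u n - (q n + q n)

    0<q : ∀ n → 0# < q n
    0<q n = bound-pos (bounded n)

    q-step : ∀ n → q (suc n) + q (suc n) ≈ q n
    q-step n = modulo (C * h ^ n) h+h≈1 (solve 3 (λ C h p →
      C :* (h :* p) :+ C :* (h :* p) := C :* p :+ (C :* p) :* (h :+ h :- con (1 , 0))) refl C h (h ^ n))

    T-dec : ∀ n → T (suc n) < T n
    T-dec n = <-from (0<y-x (proj₁ (bounded n)))
      (trans (+-congˡ (-‿cong (+-congˡ (q-step n))))
        (solve 3 (λ x y q → (x :+ (q :+ q)) :- (y :+ q) := q :- (y :- x)) refl (u n) (u (suc n)) (q n)))

    U-inc : ∀ n → U n < U (suc n)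
    U-inc n = <-from (0<y-x (proj₂ (bounded n)))
      (trans (+-congʳ (+-congˡ (-‿cong (q-step n))))
        (solve 3 (λ x y q → (y :- q) :- (x :- (q :+ q)) := q :- (:- (y :- x))) refl (u n) (u (suc n)) (q n)))

    below : ∀ j n {z} → z < T (j ℕ.+ n) → z < T n
    below zero    n z<T = z<T
    below (suc j) n z<T = below j n (<-trans z<T (T-dec (j ℕ.+ n)))

    above : ∀ j n {z} → U (j ℕ.+ n) < z → U n < z
    above zero    n U<z = U<z
    above (suc j) n U<z = above j n (<-trans (U-inc (j ℕ.+ n)) U<z)

    u<T : ∀ {N} n → N ℕ.≤ n → u n < T N
    u<T {N} n N≤n = below (n ℕ.∸ N) N
      (≡.subst (λ k → u n < T k) (≡.sym (ℕ.m∸n+n≡m N≤n))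
        (<-from (+-pos (0<q n) (0<q n))
          (solve 2 (λ x q → (x :+ q) :- x := q) refl (u n) (q n + q n))))

    U<u : ∀ {N} n → N ℕ.≤ n → U N < u n
    U<u {N} n N≤n = above (n ℕ.∸ N) N
      (≡.subst (λ k → U k < u n) (≡.sym (ℕ.m∸n+n≡m N≤n))
        (<-from (+-pos (0<q n) (0<q n))
          (solve 2 (λ x q → x :- (x :- q) := q) refl (u n) (q n + q n))))

    ε#0 : ε # 0#
    ε#0 = pos⇒#0 0<ε

    X : Carrier
    X = fromℕ 8 * C * inv ε ε#0

    N : ℕ
    N = proj₁ (archimedean X)

    small : fromℕ 4 * q N < ε
    small = <-from
      (*-pos 0<h (+-pos (*-pos 0<ε (0<y-x (proj₂ (n*h^n N))))
                        (*-pos (0<h^ N) (+-pos (*-pos 0<ε (0<y-x (proj₂ (archimedean X)))) 0<ε))))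
      (sym (modulo (ε - fromℕ 4 * q N) h+h≈1
        (modulo (- (h * h ^ N * (fromℕ 8 * C))) (inv-inverseʳ ε ε#0)
          (solve 6 (λ ε C i h p k →
            h :* (ε :* (con (2 , 0) :- (con (1 , 0) :+ k) :* p)
                  :+ p :* (ε :* (k :- con (8 , 0) :* C :* i) :+ ε))
              := ((ε :- con (4 , 0) :* (C :* p))
                  :+ (ε :- con (4 , 0) :* (C :* p)) :* (h :+ h :- con (1 , 0)))
                  :+ (:- (h :* p :* (con (8 , 0) :* C))) :* (ε :* i :- con (1 , 0)))
            refl ε C (inv ε ε#0) h (h ^ N) (fromℕ N)))))

    within : ∀ m n → N ℕ.≤ m → N ℕ.≤ n → u m - u n < ε
    within m n N≤m N≤n = <-from
      (+-pos (0<y-x small) (+-pos (0<y-x (u<T m N≤m)) (0<y-x (U<u n N≤n))))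
      (solve 5 (λ ε q x y z → ε :- (x :- y)
          := (ε :- con (4 , 0) :* q)
             :+ (((z :+ (q :+ q)) :- x) :+ (y :- (z :- (q :+ q)))))
        refl ε (q N) (u m) (u n) (u N))

  partialSum : (ℕ → Carrier) → ℕ → Carrier
  partialSum a zero    = 0#
  partialSum a (suc n) = partialSum a n + a n

  expTerm : Carrier → ℕ → Carrier
  expTerm x m = (x ^ m /ℕ (m !)) {{m ℕ.!≢0}}

  cosTerm sinTerm : Carrier → ℕ → Carrier
  cosTerm x n = (- 1#) ^ n * expTerm x (2 ℕ.* n)
  sinTerm x n = (- 1#) ^ n * expTerm x (suc (2 ℕ.* n))

  <-weaken : ∀ {x m n} → m ℕ.≤ n → x < fromℕ m → x < fromℕ n
  <-weaken {x} {m} {n} m≤n x<m =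
    ≡.subst (λ k → x < fromℕ k) (ℕ.m∸n+n≡m m≤n) (go (n ℕ.∸ m))
    where
    go : ∀ j → x < fromℕ (j ℕ.+ m)
    go zero    = x<m
    go (suc j) = <-trans (go j) (<-from 0<1
      (solve 2 (λ o x → (o :+ x) :- x := o) refl 1# (fromℕ (j ℕ.+ m))))

  Bounded-weaken : ∀ {x m n} → m ℕ.≤ n → Bounded x (fromℕ m) → Bounded x (fromℕ n)
  Bounded-weaken m≤n (p , q) = <-weaken m≤n p , <-weaken m≤n q

  bound : Carrier → ℕ
  bound x = suc (proj₁ (archimedean (x + x)) ℕ.+ proj₁ (archimedean (- (x + x))))

  bounded-by-bound : ∀ x → Bounded (x + x) (fromℕ (bound x))
  bounded-by-bound x =
      <-weaken (ℕ.m≤n⇒m≤1+n (ℕ.m≤m+n j k)) (proj₂ (archimedean (x + x)))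
    , <-weaken (ℕ.m≤n⇒m≤1+n (ℕ.m≤n+m k j)) (proj₂ (archimedean (- (x + x))))
    where
    j = proj₁ (archimedean (x + x))
    k = proj₁ (archimedean (- (x + x)))

  bounded-power : ∀ {y K} → Bounded y (fromℕ K) → ∀ m → Bounded (y ^ m) (fromℕ (K ℕ.^ m ℕ.* 2))
  bounded-power b zero =
      <-from 0<1 (solve 0 (con (2 , 0) :- con (1 , 0) := con (1 , 0)) refl)
    , <-from (0<fromℕ 2) (solve 0 (con (2 , 0) :- (:- con (1 , 0)) := con (3 , 0)) refl)
  bounded-power {y} {K} b (suc m) = Bounded-resp refl
    (trans (sym (×1-homo-* K (K ℕ.^ m ℕ.* 2)))
           (reflexive (≡.cong fromℕ (≡.sym (ℕ.*-assoc K (K ℕ.^ m) 2)))))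
    (Bounded-* b (bounded-power b m))

  h^n*2x^n : ∀ x n → h ^ n * (x + x) ^ n ≈ x ^ n
  h^n*2x^n x zero = *-identityˡ 1#
  h^n*2x^n x (suc n) = begin
    (h * h ^ n) * ((x + x) * (x + x) ^ n)
      ≈⟨ modulo _ h+h≈1 (solve 4 (λ h p x y →
           (h :* p) :* ((x :+ x) :* y)
             := x :* (p :* y) :+ (x :* (p :* y)) :* (h :+ h :- con (1 , 0))) refl h (h ^ n) x ((x + x) ^ n)) ⟩
    x * (h ^ n * (x + x) ^ n)  ≈⟨ *-congˡ (h^n*2x^n x n) ⟩
    x * x ^ n ∎

  termBound : Carrier → Carrier
  termBound x = fromℕ (bound x ℕ.^ bound x ℕ.* 2)

  expTerm-bounded : ∀ x m → Bounded (expTerm x m) (termBound x * h ^ m)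
  expTerm-bounded x m with m ! in eq | m ℕ.!≢0
  ... | suc f | _ = Bounded-resp
        (begin
          (x + x) ^ m * (h ^ m * i)  ≈⟨ solve 3 (λ y p i → y :* (p :* i) := (p :* y) :* i) refl ((x + x) ^ m) (h ^ m) i ⟩
          h ^ m * (x + x) ^ m * i    ≈⟨ *-congʳ (h^n*2x^n x m) ⟩
          x ^ m * i ∎)
        (begin
          fromℕ (K ℕ.^ K ℕ.* suc f ℕ.* 2) * (h ^ m * i)
            ≈⟨ *-congʳ (reflexive (≡.cong fromℕ (swap (K ℕ.^ K) (suc f)))) ⟩
          fromℕ (K ℕ.^ K ℕ.* 2 ℕ.* suc f) * (h ^ m * i)
            ≈⟨ *-congʳ (×1-homo-* (K ℕ.^ K ℕ.* 2) (suc f)) ⟩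
          (termBound x * fromℕ (suc f)) * (h ^ m * i)
            ≈⟨ modulo (termBound x * h ^ m) (inv-inverseʳ (fromℕ (suc f)) _)
                 (solve 4 (λ c f p i → (c :* f) :* (p :* i)
                   := c :* p :+ (c :* p) :* (f :* i :- con (1 , 0))) refl (termBound x) (fromℕ (suc f)) (h ^ m) i) ⟩
          termBound x * h ^ m ∎)
        (scale (*-pos (0<h^ m) (inv-pos _ (0<fromℕ f)))
          (Bounded-weaken
            (ℕ.*-monoˡ-≤ 2 (≡.subst (λ k → K ℕ.^ m ℕ.≤ K ℕ.^ K ℕ.* k) eq (power≤factorial K m)))
            (bounded-power (bounded-by-bound x) m)))
    where
    K = bound x
    i = inv (fromℕ (suc f)) (pos⇒#0 (0<fromℕ f))
    swap : ∀ a b → a ℕ.* b ℕ.* 2 ≡ a ℕ.* 2 ℕ.* b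
    swap a b = ≡.trans (ℕ.*-assoc a b 2)
      (≡.trans (≡.cong (a ℕ.*_) (ℕ.*-comm b 2)) (≡.sym (ℕ.*-assoc a 2 b)))
    scale : ∀ {y a p} → 0# < p → Bounded y a → Bounded (y * p) (a * p)
    scale {y} {a} {p} 0<p (q , q′) =
        <-from (*-pos (0<y-x q) 0<p) (solve 3 (λ y a p → a :* p :- y :* p := (a :- y) :* p) refl y a p)
      , <-from (*-pos (0<y-x q′) 0<p) (solve 3 (λ y a p → a :* p :- (:- (y :* p)) := (a :- (:- y)) :* p) refl y a p)

  Bounded-sign : ∀ n {x a} → Bounded x a → Bounded ((- 1#) ^ n * x) a
  Bounded-sign zero    {x} b = Bounded-resp (sym (*-identityˡ x)) refl b
  Bounded-sign (suc n) {x} b = Bounded-resp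
    (solve 2 (λ s x → :- (s :* x) := ((:- con (1 , 0)) :* s) :* x) refl ((- 1#) ^ n) x)
    refl (Bounded-neg (Bounded-sign n b))

  Bounded-drop : ∀ j n {x c} → Bounded x (c * h ^ (j ℕ.+ n)) → Bounded x (c * h ^ n)
  Bounded-drop zero    n b = b
  Bounded-drop (suc j) n {x} {c} b@(p , q) = Bounded-drop j n (<-trans p less , <-trans q less)
    where
    less : c * (h * h ^ (j ℕ.+ n)) < c * h ^ (j ℕ.+ n)
    less = <-from (bound-pos b) (modulo (- (c * h ^ (j ℕ.+ n))) h+h≈1
      (solve 3 (λ c h p → c :* p :- c :* (h :* p)
        := c :* (h :* p) :+ (:- (c :* p)) :* (h :+ h :- con (1 , 0))) refl c h (h ^ (j ℕ.+ n))))

  series-cauchy : ∀ a c → (∀ n → Bounded (a n) (c * h ^ n)) → IsCauchy (partialSum a)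
  series-cauchy a c b = geometric-cauchy (partialSum a) c λ n → Bounded-resp
    (solve 2 (λ s t → t := (s :+ t) :- s) refl (partialSum a n) (a n)) refl (b n)

  cos-cauchy : ∀ x → IsCauchy (partialSum (cosTerm x))
  cos-cauchy x = series-cauchy (cosTerm x) (termBound x) λ n →
    Bounded-sign n (Bounded-drop n n
      (≡.subst (λ k → Bounded (expTerm x (2 ℕ.* n)) (termBound x * h ^ k))
        (≡.cong (n ℕ.+_) (ℕ.+-identityʳ n)) (expTerm-bounded x (2 ℕ.* n))))

  sin-cauchy : ∀ x → IsCauchy (partialSum (sinTerm x))
  sin-cauchy x = series-cauchy (sinTerm x) (termBound x) λ n →
    Bounded-sign n (Bounded-drop (suc n) n
      (≡.subst (λ k → Bounded (expTerm x (suc (2 ℕ.* n))) (termBound x * h ^ suc k))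
        (≡.cong (n ℕ.+_) (ℕ.+-identityʳ n)) (expTerm-bounded x (suc (2 ℕ.* n)))))

  cos sin : Carrier → Carrier
  cos x = proj₁ (complete (partialSum (cosTerm x)) (cos-cauchy x))
  sin x = proj₁ (complete (partialSum (sinTerm x)) (sin-cauchy x))

  -- π is the least positive zero of sin: positively, sin t is apart from 0 for
  -- 0 < t < π.  At most one real number satisfies this, and likewise at most
  -- one function (up to _≈_) satisfies IsArctan π.
  IsPi : Carrier → Set (c ⊔ ℓ₁ ⊔ ℓ₂ ⊔ ℓ₃)
  IsPi π = 0# < π × sin π ≈ 0# × (∀ t → 0# < t → t < π → sin t # 0#)

  tan : ∀ x → cos x # 0# → Carrier
  tan x cos#0 = sin x / cos x [ cos#0 ]

  -- arctan is the inverse of the restriction of tan to (-π/2 , π/2).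
  IsArctan : Carrier → (Carrier → Carrier) → Set (c ⊔ ℓ₁ ⊔ ℓ₂ ⊔ ℓ₃)
  IsArctan π arctan = ∀ x →
    - (π /ℕ 2) < arctan x × arctan x < π /ℕ 2 ×
    (Σ[ cos#0 ∈ cos (arctan x) # 0# ] tan (arctan x) cos#0 ≈ x)

  private
    r : Carrier
    r = 1# /ℕ 6

    0<r : 0# < r
    0<r = /ℕ-pos 6 0<1

    6r≈1 : fromℕ 6 * r ≈ 1#
    6r≈1 = *-/ℕ 1# 6

    -- x ↦ x + (5 - x²) / 6 iterated from 2 increases to √5.
    approx step : ℕ → Carrier
    step n = r * (fromℕ 5 - approx n * approx n)
    approx zero    = fromℕ 2
    approx (suc n) = approx n + step n

    record Invariant (n : ℕ) : Set ℓ₃ where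
      field
        lower   : fromℕ 3 < approx n + approx n
        upper   : approx n < fromℕ 3
        0<step  : 0# < step n
        step<h^ : step n < h ^ n

    invariant : ∀ n → Invariant n
    invariant zero = record
      { lower   = <-from 0<1 (solve 0 ((con (2 , 0) :+ con (2 , 0)) :- con (3 , 0) := con (1 , 0)) refl)
      ; upper   = <-from 0<1 (solve 0 (con (3 , 0) :- con (2 , 0) := con (1 , 0)) refl)
      ; 0<step  = <-from 0<r (solve 1 (λ r →
                    r :* (con (5 , 0) :- con (2 , 0) :* con (2 , 0)) :- con (0 , 0) := r) refl r)
      ; step<h^ = <-from (*-pos (0<fromℕ 4) 0<r) (modulo (- 1#) 6r≈1 (solve 1 (λ r →
                    con (1 , 0) :- r :* (con (5 , 0) :- con (2 , 0) :* con (2 , 0))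
                      := con (5 , 0) :* r :+ (:- con (1 , 0)) :* (con (6 , 0) :* r :- con (1 , 0))) refl r))
      }
    invariant (suc n) = record
      { lower   = <-trans lower (<-from (+-pos 0<step 0<step) (solve 2 (λ x d →
                    ((x :+ d) :+ (x :+ d)) :- (x :+ x) := d :+ d) refl x d))
      ; upper   = upper′
      ; 0<step  = <-respʳ-≈ (sym d′≈) (*-pos 0<step 0<f)
      ; step<h^ = <-from
          (+-pos (*-pos 0<h (0<y-x step<h^)) (*-pos 0<step (*-pos 0<r (+-pos (0<y-x lower) 0<step))))
          (begin
            h * h ^ n - d′ ≈⟨ +-congˡ (-‿cong d′≈) ⟩
            h * h ^ n - d * f ≈⟨ modulo (- d * h) 6r≈1 (modulo (d * (fromℕ 3 * r)) h+h≈1 (solve 5 (λ h p d r x →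
              h :* p :- d :* (r :* ((con (3 , 0) :- x) :+ (con (3 , 0) :- (x :+ d))))
                := ((h :* (p :- d) :+ d :* (r :* (((x :+ x) :- con (3 , 0)) :+ d)))
                    :+ (:- d) :* h :* (con (6 , 0) :* r :- con (1 , 0)))
                    :+ d :* (con (3 , 0) :* r) :* (h :+ h :- con (1 , 0))) refl h (h ^ n) d r x)) ⟩
            h * (h ^ n - d) + d * (r * ((x + x - fromℕ 3) + d)) ∎)
      }
      where
      open Invariant (invariant n)
      x = approx n
      d = step n
      d′ = step (suc n)
      upper′ : x + d < fromℕ 3
      upper′ = <-from (*-pos 0<r (+-pos (*-pos (0<y-x upper) (0<y-x upper)) (0<fromℕ 3)))
        (modulo (x - fromℕ 3) 6r≈1 (solve 2 (λ x r →
          con (3 , 0) :- (x :+ r :* (con (5 , 0) :- x :* x))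
            := r :* ((con (3 , 0) :- x) :* (con (3 , 0) :- x) :+ con (4 , 0))
               :+ (x :- con (3 , 0)) :* (con (6 , 0) :* r :- con (1 , 0))) refl x r))
      f : Carrier
      f = r * ((fromℕ 3 - x) + (fromℕ 3 - (x + d)))
      0<f : 0# < f
      0<f = *-pos 0<r (+-pos (0<y-x upper) (0<y-x upper′))
      d′≈ : d′ ≈ d * f
      d′≈ = modulo (- d) 6r≈1 (solve 2 (λ x r →
        let d = r :* (con (5 , 0) :- x :* x) in
        r :* (con (5 , 0) :- (x :+ d) :* (x :+ d))
          := d :* (r :* ((con (3 , 0) :- x) :+ (con (3 , 0) :- (x :+ d))))
             :+ (:- d) :* (con (6 , 0) :* r :- con (1 , 0))) refl x r)

    approx-cauchy : IsCauchy approx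
    approx-cauchy = geometric-cauchy approx 1# λ n →
      let open Invariant (invariant n)
          x = approx n
          d = step n
      in  <-from (0<y-x step<h^) (solve 3 (λ p x d →
            con (1 , 0) :* p :- ((x :+ d) :- x) := p :- d) refl (h ^ n) x d)
        , <-from (+-pos (0<h^ n) 0<step) (solve 3 (λ p x d →
            con (1 , 0) :* p :- (:- ((x :+ d) :- x)) := p :+ d) refl (h ^ n) x d)

  sqrt5 : ∃ λ s → 1# < s × s * s ≈ fromℕ 5
  sqrt5 = l , 1<l , tight _ _ .proj₁ λ l²#5 → not# (#⇒<⊎> l²#5)
    where
    limit = complete approx approx-cauchy
    l = proj₁ limit

    1<l : 1# < l
    1<l = <-from
      (+-pos (0<y-x (proj₁ (proj₂ (proj₂ limit h 0<h) N ℕ.≤-refl))) (*-pos 0<h (0<y-x lower)))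
      (modulo (1# - approx N) h+h≈1 (solve 3 (λ a l h →
        l :- con (1 , 0) := ((h :- (a :- l)) :+ h :* ((a :+ a) :- con (3 , 0)))
          :+ (con (1 , 0) :- a) :* (h :+ h :- con (1 , 0))) refl (approx N) l h))
      where
      N = proj₁ (proj₂ limit h 0<h)
      open Invariant (invariant N)

    l²≈5-within : ∀ ε → 0# < ε → Within ε (l * l) (fromℕ 5)
    l²≈5-within ε 0<ε =
        <-from (+-pos (0<y-x (proj₂ w)) (+-pos (*-pos (0<fromℕ 5) 0<d) (*-pos (0<fromℕ 12) 0<δ)))
          (trans (+-congʳ (sym (*-/ℕ ε 20))) (modulo (x * x - fromℕ 5) 6r≈1 (solve 4 (λ x l r δ →
            con (20 , 0) :* δ :- (l :* l :- con (5 , 0))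
              := ((δ :* con (7 , 0) :- (:- ((x :- l) :* (x :+ l))))
                  :+ (con (6 , 0) :* (r :* (con (5 , 0) :- x :* x)) :+ con (13 , 0) :* δ))
                 :+ (x :* x :- con (5 , 0)) :* (con (6 , 0) :* r :- con (1 , 0))) refl x l r δ)))
      , <-from (+-pos (*-pos (0<fromℕ 5) (0<y-x d<2δ)) (+-pos (0<y-x (proj₁ w)) 0<δ))
          (trans (+-congʳ (sym (*-/ℕ ε 20))) (modulo (fromℕ 5 - x * x) 6r≈1 (solve 4 (λ x l r δ →
            con (20 , 0) :* δ :- (con (5 , 0) :- l :* l)
              := (con (6 , 0) :* (con (2 , 0) :* δ :- r :* (con (5 , 0) :- x :* x))
                  :+ ((δ :* con (7 , 0) :- ((x :- l) :* (x :+ l))) :+ δ))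
                 :+ (con (5 , 0) :- x :* x) :* (con (6 , 0) :* r :- con (1 , 0))) refl x l r δ)))
      where
      δ = ε /ℕ 20
      0<δ : 0# < δ
      0<δ = /ℕ-pos 20 0<ε
      N₁ = proj₁ (proj₂ limit δ 0<δ)
      N₂ = proj₁ (proj₂ limit 1# 0<1)
      n = N₁ ℕ.+ N₂
      x = approx n
      d = step n
      open Invariant (invariant n)
      close : Within δ x l
      close = proj₂ (proj₂ limit δ 0<δ) n (ℕ.m≤m+n N₁ N₂)
      close′ : Within δ (x + d) l
      close′ = proj₂ (proj₂ limit δ 0<δ) (suc n) (ℕ.m≤n⇒m≤1+n (ℕ.m≤m+n N₁ N₂))
      close₁ : Within 1# x l
      close₁ = proj₂ (proj₂ limit 1# 0<1) n (ℕ.m≤n+m N₂ N₁)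
      0<d : 0# < d
      0<d = 0<step
      d<2δ : d < fromℕ 2 * δ
      d<2δ = <-from (+-pos (0<y-x (proj₁ close′)) (0<y-x (proj₂ close)))
        (solve 4 (λ x d l δ → con (2 , 0) :* δ :- d
          := (δ :- ((x :+ d) :- l)) :+ (δ :- (l :- x))) refl x d l δ)
      w : Bounded ((x - l) * (x + l)) (δ * fromℕ 7)
      w = Bounded-*
        ( proj₁ close
        , <-respˡ-≈ (solve 2 (λ x l → l :- x := :- (x :- l)) refl x l) (proj₂ close))
        ( <-from (+-pos (*-pos (0<fromℕ 1) (0<y-x upper)) (0<y-x (proj₂ close₁)))
            (solve 2 (λ x l → con (7 , 0) :- (x :+ l)
              := con (2 , 0) :* (con (3 , 0) :- x) :+ (con (1 , 0) :- (l :- x))) refl x l)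
        , <-from (+-pos (0<y-x (proj₁ close₁)) (+-pos (0<y-x lower) (0<fromℕ 8)))
            (solve 2 (λ x l → con (7 , 0) :- (:- (x :+ l))
              := (con (1 , 0) :- (x :- l)) :+ (((x :+ x) :- con (3 , 0)) :+ con (9 , 0))) refl x l))

    not# : l * l < fromℕ 5 ⊎ fromℕ 5 < l * l → ⊥
    not# (inj₁ l²<5) = <-irrefl refl (proj₂ (l²≈5-within _ (0<y-x l²<5)))
    not# (inj₂ 5<l²) = <-irrefl refl (proj₁ (l²≈5-within _ (0<y-x 5<l²)))

  √5 φ : Carrier
  √5 = proj₁ sqrt5
  φ  = (1# + √5) /ℕ 2

  1<φ : 1# < φ
  1<φ = <-from (*-pos (0<y-x (proj₁ (proj₂ sqrt5))) 0<h) (modulo 1# h+h≈1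
    (trans (+-congʳ (*-congˡ (sym (*-identityˡ i))))
      (solve 2 (λ s h → (con (1 , 0) :+ s) :* h :- con (1 , 0)
        := (s :- con (1 , 0)) :* h :+ (con (1 , 0)) :* (h :+ h :- con (1 , 0))) refl √5 h)))
    where i = inv (fromℕ 2) (pos⇒#0 (0<fromℕ 1))

  0<φ^ : ∀ n → 0# < φ ^ n
  0<φ^ zero    = 0<1
  0<φ^ (suc n) = *-pos (<-trans 0<1 1<φ) (0<φ^ n)

  φ^#0 : ∀ n → φ ^ n # 0#
  φ^#0 n = pos⇒#0 (0<φ^ n)

  1<2φ^ : ∀ n → 1# < φ ^ n + φ ^ n
  1<2φ^ zero = <-from 0<1
    (solve 0 ((con (1 , 0) :+ con (1 , 0)) :- con (1 , 0) := con (1 , 0)) refl)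
  1<2φ^ (suc n) = <-from
    (+-pos (0<y-x (1<2φ^ n)) (*-pos (0<y-x 1<φ) (+-pos (0<φ^ n) (0<φ^ n))))
    (solve 2 (λ f p → (f :* p :+ f :* p) :- con (1 , 0)
      := ((p :+ p) :- con (1 , 0)) :+ (f :- con (1 , 0)) :* (p :+ p)) refl φ (φ ^ n))

  1≤L : ∀ n → 1 ℕ.≤ L n
  1≤L 0             = s≤s z≤n
  1≤L 1             = s≤s z≤n
  1≤L (suc (suc n)) = ℕ.≤-trans (1≤L (suc n)) (ℕ.m≤m+n (L (suc n)) (L n))

  2≤L-even : ∀ k → 2 ℕ.≤ L (2 ℕ.* k)
  2≤L-even zero = ℕ.≤-refl
  2≤L-even (suc k) rewrite ℕ.*-suc 2 k =
    ℕ.+-mono-≤ (1≤L (suc (2 ℕ.* k))) (1≤L (2 ℕ.* k))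

  denominator : ℕ → Carrier
  denominator k = - fromℕ 2 + (fromℕ (L (2 ℕ.* k)) + fromℕ 2) * φ ^ (2 ℕ.* k)

  denominator#0 : ∀ k → denominator k # 0#
  denominator#0 k = pos⇒#0 (go (L (2 ℕ.* k)) (2≤L-even k))
    where
    p = φ ^ (2 ℕ.* k)
    p+p-1 : 0# < (p + p) - 1#
    p+p-1 = 0<y-x (1<2φ^ (2 ℕ.* k))
    go : ∀ m → 2 ℕ.≤ m → 0# < - fromℕ 2 + (fromℕ m + fromℕ 2) * p
    go 1 (s≤s ())
    go (suc (suc zero)) _ = <-respʳ-≈
      (solve 1 (λ p → con (2 , 0) :* ((p :+ p) :- con (1 , 0))
        := :- con (2 , 0) :+ (con (2 , 0) :+ con (2 , 0)) :* p) refl p)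
      (*-pos (0<fromℕ 1) p+p-1)
    go (suc (suc (suc m))) _ = <-respʳ-≈
      (solve 2 (λ m p → con (2 , 0) :* ((p :+ p) :- con (1 , 0)) :+ m :* p
        := :- con (2 , 0) :+ ((con (1 , 0) :+ (con (1 , 0) :+ m)) :+ con (2 , 0)) :* p)
        refl (fromℕ (suc m)) p)
      (+-pos (*-pos (0<fromℕ 1) p+p-1) (*-pos (0<fromℕ m) (0<φ^ (2 ℕ.* k))))

{-# OPTIONS --safe #-}
-- The addition formulas follow by multiplying the power series of cos and sin: the
-- coefficients of both are determined by C′ = - x S, S′ = x C, so by the Leibniz rule
-- the Cauchy products satisfy the same recurrence as the series at x + y.  Next, cos has
-- no zero on (0 , π/2) since sin 2t = 2 sin t cos t has none, so it is positive there by
-- bisection; and sin is positive there because it is positive near 0.  This gives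
-- cos (π/4) = sin (π/4).
--
-- With p = φ²ᵏ and i = 1/p, Binet's formula L₂ₖ p = p² + 1 turns the second argument r
-- of arctan into (1 - 2i - i²) / (1 + 2i - i²).  For θ = 2 arctan i + arctan r this means
-- sin θ = cos θ > 0, so x = θ - π/4 has sin x = 0 < cos x.  Hence cos x = 1 and
-- sin (x/2) = 0, and |x/2| < π forces x = 0.

module Submission where

open import Defs
open import Level using (_⊔_)
open import Data.Empty using (⊥; ⊥-elim)
open import Data.Nat.Base as ℕ using (ℕ; zero; suc; _!)
import Data.Nat.Properties as ℕ
open import Data.Product.Base using (∃; _×_; _,_; proj₁; proj₂; Σ-syntax)
open import Data.Sum.Base using (_⊎_; inj₁; inj₂)
import Relation.Binary.PropositionalEquality.Core as ≡
open import Relation.Binary.Structures using (IsStrictPartialOrder)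
open import Relation.Nullary.Negation.Core using (¬_)
open import Algebra.Bundles using (CommutativeRing)
open import Algebra.Apartness.Bundles using (HeytingField)
import Algebra.Apartness.Properties.HeytingCommutativeRing as HeytingProperties
import Algebra.Properties.Semiring.Mult as SemiringMult
import Relation.Binary.Reasoning.Setoid as SetoidReasoning

-- The order of the constructive reals is undecidable, and what `IsPi` and `IsArctan` say about
-- signs is mostly apartness from 0. Signs are therefore obtained in two steps: the wrong sign is
-- refuted, where a three-way case distinction is legitimate because the goal is `⊥`, and a known
-- apartness then makes the weak inequality strict. Bisection works for the same reason: apartness
-- decides the sign at each midpoint. The angle θ is pinned down by its sine and cosine instead of
-- by monotonicity of tan. The range conditions give only |θ| < 3π/2, where tan θ = 1 also holds at
-- -3π/4 and 5π/4; cos is negative at both, which is why cos θ > 0 has to be shown. The same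
-- conditions give |x| < 2π, the largest symmetric range on which sin x = 0 < cos x singles out x =
-- 0.

module Trigonometry {c ℓ₁ ℓ₂ ℓ₃} (ℝ : RealNumbers c ℓ₁ ℓ₂ ℓ₃) where

  open RealNumbers ℝ
  open RealAnalysis ℝ hiding (cos; sin)
  open CommutativeRing commutativeRing using (semiring)
  open SemiringMult semiring using (×-homo-+; ×1-homo-*)
  open HeytingProperties (HeytingField.heytingCommutativeRing heytingField)
    using (#-congʳ; x#0y#0→xy#0; invertibleˡ⇒#)
  open IsStrictPartialOrder isStrictPartialOrder using (<-respʳ-≈; <-respˡ-≈)
    renaming (irrefl to <-irrefl; trans to <-trans)
  open SetoidReasoning setoid
  open Solver using (solve; con; _:=_; _:+_; _:*_; _:-_; :-_)

  infix 4 _≤_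

  _≤_ : Carrier → Carrier → Set ℓ₃
  x ≤ y = ¬ (y < x)

  -- Order

  <-asym : ∀ {x y} → x < y → ¬ (y < x)
  <-asym x<y y<x = <-irrefl refl (<-trans x<y y<x)

  -- The substitute for comparing `z` with a given number: apartness is cotransitive, and if `z`
  -- lies on the unexpected side of one end, transitivity with `x<y` places it beyond the other.
  <-cotrans : ∀ {x y} → x < y → ∀ z → x < z ⊎ z < y
  <-cotrans x<y z with #-cotrans (<⇒# x<y) z
  ... | inj₁ x#z with #⇒<⊎> x#z
  ...   | inj₁ x<z = inj₁ x<z
  ...   | inj₂ z<x = inj₂ (<-trans z<x x<y)
  <-cotrans x<y z | inj₂ z#y with #⇒<⊎> z#y
  ...   | inj₁ z<y = inj₂ z<y
  ...   | inj₂ y<z = inj₁ (<-trans x<y y<z)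

  ≤-<-trans : ∀ {x y z} → x ≤ y → y < z → x < z
  ≤-<-trans {x} x≤y y<z with <-cotrans y<z x
  ... | inj₁ y<x = ⊥-elim (x≤y y<x)
  ... | inj₂ x<z = x<z

  <-≤-trans : ∀ {x y z} → x < y → y ≤ z → x < z
  <-≤-trans {z = z} x<y y≤z with <-cotrans x<y z
  ... | inj₁ x<z = x<z
  ... | inj₂ z<y = ⊥-elim (y≤z z<y)

  #∧≤⇒< : ∀ {x y} → x # y → x ≤ y → x < y
  #∧≤⇒< x#y x≤y with #⇒<⊎> x#y
  ... | inj₁ x<y = x<y
  ... | inj₂ y<x = ⊥-elim (x≤y y<x)

  ≤-antisym : ∀ {x y} → x ≤ y → y ≤ x → x ≈ y
  ≤-antisym {x} {y} x≤y y≤x = proj₁ (tight x y) λ x#y → y≤x (#∧≤⇒< x#y x≤y)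

  -- A proof of `⊥` may split into three cases although the order is undecidable: by tightness, two
  -- numbers with neither strict order between them are equal.
  trichotomy-⊥ : ∀ {x y} → ¬ (x < y) → ¬ (x ≈ y) → ¬ (y < x) → ⊥
  trichotomy-⊥ y≤x x≉y x≤y = x≉y (≤-antisym x≤y y≤x)

  neg-pos : ∀ {x} → x < 0# → 0# < - x
  neg-pos {x} x<0 = <-respʳ-≈ (+-identityˡ (- x)) (0<y-x x<0)

  square-≥0 : ∀ x → 0# ≤ x * x
  square-≥0 x x²<0 = trichotomy-⊥
    (λ x<0 → <-asym x²<0 (<-respʳ-≈ (solve 1 (λ x → (:- x) :* (:- x) := x :* x) refl x)
      (*-pos (neg-pos x<0) (neg-pos x<0))))
    (λ x≈0 → <-irrefl (trans (*-congʳ x≈0) (solve 1 (λ x → con (0 , 0) :* x := con (0 , 0)) refl x)) x²<0)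
    (λ 0<x → <-asym x²<0 (*-pos 0<x 0<x))

  *-cancelˡ : ∀ {a x y} → a # 0# → a * x ≈ a * y → x ≈ y
  *-cancelˡ {a} {x} {y} a#0 e = begin
    x               ≈⟨ modulo (- x) (inv-inverseʳ a a#0) (solve 3 (λ a i x →
                         x := i :* (a :* x) :+ (:- x) :* (a :* i :- con (1 , 0))) refl a i x) ⟩
    i * (a * x)     ≈⟨ *-congˡ e ⟩
    i * (a * y)     ≈⟨ modulo y (inv-inverseʳ a a#0) (solve 3 (λ a i x →
                         i :* (a :* x) := x :+ x :* (a :* i :- con (1 , 0))) refl a i y) ⟩
    y ∎
    where i = inv a a#0

  square≈0⇒≈0 : ∀ {x} → x * x ≈ 0# → x ≈ 0#
  square≈0⇒≈0 {x} e = proj₁ (tight x 0#) λ x#0 →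
    proj₂ (tight (x * x) 0#) e (x#0y#0→xy#0 x#0 x#0)

  -- Bounds

  Bounded-+ : ∀ {x y a b} → Bounded x a → Bounded y b → Bounded (x + y) (a + b)
  Bounded-+ {x} {y} {a} {b} (p , p′) (q , q′) =
      <-from (+-pos (0<y-x p) (0<y-x q)) (solve 4 (λ x y a b →
        (a :+ b) :- (x :+ y) := (a :- x) :+ (b :- y)) refl x y a b)
    , <-from (+-pos (0<y-x p′) (0<y-x q′)) (solve 4 (λ x y a b →
        (a :+ b) :- (:- (x :+ y)) := (a :- (:- x)) :+ (b :- (:- y))) refl x y a b)

  Bounded-scale : ∀ {x a p} → 0# < p → Bounded x a → Bounded (p * x) (p * a)
  Bounded-scale {x} {a} {p} 0<p (q , q′) =
      <-from (*-pos 0<p (0<y-x q)) (solve 3 (λ x a p →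
        p :* a :- p :* x := p :* (a :- x)) refl x a p)
    , <-from (*-pos 0<p (0<y-x q′)) (solve 3 (λ x a p →
        p :* a :- (:- (p :* x)) := p :* (a :- (:- x))) refl x a p)

  Bounded-mono : ∀ {x a b} → a < b → Bounded x a → Bounded x b
  Bounded-mono a<b (p , q) = <-trans p a<b , <-trans q a<b

  Bounded-0 : ∀ {a} → 0# < a → Bounded 0# a
  Bounded-0 0<a = 0<a , <-respˡ-≈ (solve 0 (con (0 , 0) := :- con (0 , 0)) refl) 0<a

  Bounded-pos : ∀ {x a} → 0# < x → x < a → Bounded x a
  Bounded-pos {x} {a} 0<x x<a = x<a ,
    <-trans (<-from 0<x (solve 1 (λ x → con (0 , 0) :- (:- x) := x) refl x)) (<-trans 0<x x<a)

  every-bounded : ∀ x → ∃ λ a → Bounded x a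
  every-bounded x = h * fromℕ (bound x) , Bounded-resp
    (modulo x h+h≈1 (solve 2 (λ h x → h :* (x :+ x) := x :+ x :* (h :+ h :- con (1 , 0))) refl h x))
    refl (Bounded-scale 0<h (bounded-by-bound x))

  Bounded⇒Within : ∀ {ε x y} → Bounded (x - y) ε → Within ε x y
  Bounded⇒Within {ε} {x} {y} (p , q) =
    p , <-respˡ-≈ (solve 2 (λ x y → :- (x :- y) := y :- x) refl x y) q

  Within⇒Bounded : ∀ {ε x y} → Within ε x y → Bounded (x - y) ε
  Within⇒Bounded {ε} {x} {y} (p , q) =
    p , <-respˡ-≈ (solve 2 (λ x y → y :- x := :- (x :- y)) refl x y) q

  -- Limits

  ⟶-cong : ∀ {u v l m} → (∀ n → u n ≈ v n) → l ≈ m → u ⟶ l → v ⟶ m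
  ⟶-cong u≈v l≈m u⟶l ε 0<ε with u⟶l ε 0<ε
  ... | N , close = N , λ n N≤n →
      <-respˡ-≈ (+-cong (u≈v n) (-‿cong l≈m)) (proj₁ (close n N≤n))
    , <-respˡ-≈ (+-cong l≈m (-‿cong (u≈v n))) (proj₂ (close n N≤n))

  ⟶-const : ∀ l → (λ _ → l) ⟶ l
  ⟶-const l ε 0<ε = 0 , λ n _ → d , d
    where d = <-respˡ-≈ (sym (-‿inverseʳ l)) 0<ε

  ⟶-suc : ∀ {u l} → u ⟶ l → (λ n → u (suc n)) ⟶ l
  ⟶-suc u⟶l ε 0<ε with u⟶l ε 0<ε
  ... | N , close = N , λ n N≤n → close (suc n) (ℕ.m≤n⇒m≤1+n N≤n)

  -- If `m < l`, then for large n the midpoint of `m` and `l` lies below `u n` and above `v n`.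
  ⟶-≤ : ∀ {u v l m} → u ⟶ l → v ⟶ m → (∀ n → u n ≤ v n) → l ≤ m
  ⟶-≤ {u} {v} {l} {m} u⟶l v⟶m u≤v m<l = u≤v n (<-from
    (+-pos (0<y-x (proj₂ (proj₂ U n (ℕ.m≤m+n _ _)))) (0<y-x (proj₁ (proj₂ V n (ℕ.m≤n+m _ _)))))
    (modulo (m - l) h+h≈1 (solve 5 (λ u v l m h →
      u :- v := ((h :* (l :- m) :- (l :- u)) :+ (h :* (l :- m) :- (v :- m)))
        :+ (m :- l) :* (h :+ h :- con (1 , 0))) refl (u n) (v n) l m h)))
    where
    0<δ : 0# < h * (l - m)
    0<δ = *-pos 0<h (0<y-x m<l)
    U = u⟶l _ 0<δ
    V = v⟶m _ 0<δ
    n = proj₁ U ℕ.+ proj₁ V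

  ⟶-unique : ∀ {u l m} → u ⟶ l → u ⟶ m → l ≈ m
  ⟶-unique u⟶l u⟶m =
    ≤-antisym (⟶-≤ u⟶l u⟶m λ _ → <-irrefl refl) (⟶-≤ u⟶m u⟶l λ _ → <-irrefl refl)

  -- A strict bound only survives as a weak one in the limit; the gap between `a` and `b` restores
  -- strictness.
  ⟶-bounded : ∀ {u l a b} → u ⟶ l → (∀ n → Bounded (u n) a) → a < b → Bounded l b
  ⟶-bounded {u} {l} {a} {b} u⟶l bounded a<b =
      ≤-<-trans (⟶-≤ u⟶l (⟶-const a) λ n → <-asym (proj₁ (bounded n))) a<b
    , ≤-<-trans (λ a<-l → -a≤l (<-from (0<y-x a<-l)
        (solve 2 (λ l a → (:- a) :- l := (:- l) :- a) refl l a))) a<b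
    where
    -a≤l : - a ≤ l
    -a≤l = ⟶-≤ (⟶-const (- a)) u⟶l λ n → <-asym (<-from (0<y-x (proj₂ (bounded n)))
      (solve 2 (λ u a → u :- (:- a) := a :- (:- u)) refl (u n) a))

  ⟶-+ : ∀ {u v l m} → u ⟶ l → v ⟶ m → (λ n → u n + v n) ⟶ l + m
  ⟶-+ {u} {v} {l} {m} u⟶l v⟶m ε 0<ε = N₁ ℕ.+ N₂ , λ n N≤n → Bounded⇒Within (Bounded-resp
    (solve 4 (λ u v l m → (u :- l) :+ (v :- m) := (u :+ v) :- (l :+ m)) refl (u n) (v n) l m)
    (modulo ε h+h≈1 (solve 2 (λ h ε → h :* ε :+ h :* ε := ε :+ ε :* (h :+ h :- con (1 , 0))) refl h ε))
    (Bounded-+ (Within⇒Bounded (close₁ n (ℕ.≤-trans (ℕ.m≤m+n N₁ N₂) N≤n)))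
               (Within⇒Bounded (close₂ n (ℕ.≤-trans (ℕ.m≤n+m N₂ N₁) N≤n)))))
    where
    U = u⟶l (h * ε) (*-pos 0<h 0<ε)
    V = v⟶m (h * ε) (*-pos 0<h 0<ε)
    N₁ = proj₁ U
    N₂ = proj₁ V
    close₁ = proj₂ U
    close₂ = proj₂ V

  ⟶-neg : ∀ {u l} → u ⟶ l → (λ n → - u n) ⟶ - l
  ⟶-neg {u} {l} u⟶l ε 0<ε with u⟶l ε 0<ε
  ... | N , close = N , λ n N≤n →
      <-respˡ-≈ (solve 2 (λ u l → l :- u := (:- u) :- (:- l)) refl (u n) l) (proj₂ (close n N≤n))
    , <-respˡ-≈ (solve 2 (λ u l → u :- l := (:- l) :- (:- u)) refl (u n) l) (proj₁ (close n N≤n))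

  -- Rests on uv - lm = (u - l)v + l(v - m). The separate bound 1 on v - m gives |v| < 1 + b
  -- independently of δ, so the final error is linear in δ.
  product-difference-bounded : ∀ {u v l m a b δ} → Bounded l a → Bounded m b →
    Bounded (u - l) δ → Bounded (v - m) δ → Bounded (v - m) 1# →
    Bounded (u * v - l * m) (δ * (1# + b + a))
  product-difference-bounded {u} {v} {l} {m} {a} {b} {δ} |l|<a |m|<b p q r = Bounded-resp
    (solve 4 (λ u v l m → (u :- l) :* ((v :- m) :+ m) :+ l :* (v :- m) := u :* v :- l :* m)
      refl u v l m)
    (solve 3 (λ δ a b → δ :* (con (1 , 0) :+ b) :+ a :* δ := δ :* (con (1 , 0) :+ b :+ a))
      refl δ a b)
    (Bounded-+ (Bounded-* p (Bounded-+ r |m|<b)) (Bounded-* |l|<a q))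

  ⟶-* : ∀ {u v l m} → u ⟶ l → v ⟶ m → (λ n → u n * v n) ⟶ l * m
  ⟶-* {u} {v} {l} {m} u⟶l v⟶m ε 0<ε = go (every-bounded l) (every-bounded m)
    where
    go : (∃ λ a → Bounded l a) → (∃ λ b → Bounded m b) →
         ∃ λ N → ∀ n → N ℕ.≤ n → Within ε (u n * v n) (l * m)
    go (a , |l|<a) (b , |m|<b) = N₁ ℕ.+ (N₂ ℕ.+ N₃) , λ n N≤n →
      let N≤ = ℕ.≤-trans (ℕ.m≤n+m (N₂ ℕ.+ N₃) N₁) N≤n in
      Bounded⇒Within (Bounded-resp refl δs≈ε (product-difference-bounded |l|<a |m|<b
        (Within⇒Bounded (proj₂ (u⟶l δ 0<δ) n (ℕ.≤-trans (ℕ.m≤m+n N₁ _) N≤n)))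
        (Within⇒Bounded (proj₂ (v⟶m δ 0<δ) n (ℕ.≤-trans (ℕ.m≤m+n N₂ N₃) N≤)))
        (Within⇒Bounded (proj₂ (v⟶m 1# 0<1) n (ℕ.≤-trans (ℕ.m≤n+m N₃ N₂) N≤)))))
      where
      s = 1# + b + a
      0<s : 0# < s
      0<s = +-pos (+-pos 0<1 (bound-pos |m|<b)) (bound-pos |l|<a)
      s#0 = pos⇒#0 0<s
      δ = ε * inv s s#0
      δs≈ε : δ * s ≈ ε
      δs≈ε = trans (*-assoc _ _ _) (trans (*-congˡ (trans (*-comm _ s) (inv-inverseʳ s s#0)))
        (*-identityʳ ε))
      0<δ : 0# < δ
      0<δ = *-pos 0<ε (inv-pos s#0 0<s)
      N₁ = proj₁ (u⟶l δ 0<δ)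
      N₂ = proj₁ (v⟶m δ 0<δ)
      N₃ = proj₁ (v⟶m 1# 0<1)

  -- 2 a p < k ε p < 2 ε.
  archimedean-bound : ∀ {a ε k p i} → 0# < ε → 0# < p → ε * i ≈ 1# →
    fromℕ 2 * a * i < k → (1# + k) * p < fromℕ 2 → a * p < ε
  archimedean-bound {a} {ε} {k} {p} {i} 0<ε 0<p εi≈1 2ai<k kp<2 = <-from
    (*-pos 0<h (+-pos (*-pos 0<ε (0<y-x kp<2)) (*-pos 0<p (+-pos 0<kε-2a 0<ε))))
    (sym (modulo (ε - a * p) h+h≈1 (solve 5 (λ a ε k p h →
      h :* (ε :* (con (2 , 0) :- (con (1 , 0) :+ k) :* p) :+ p :* ((ε :* k :- con (2 , 0) :* a) :+ ε))
        := (ε :- a :* p) :+ (ε :- a :* p) :* (h :+ h :- con (1 , 0))) refl a ε k p h)))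
    where
    0<kε-2a : 0# < ε * k - fromℕ 2 * a
    0<kε-2a = <-respʳ-≈ (modulo (- (fromℕ 2 * a)) εi≈1 (solve 4 (λ a ε k i →
      ε :* (k :- con (2 , 0) :* a :* i)
        := (ε :* k :- con (2 , 0) :* a) :+ (:- (con (2 , 0) :* a)) :* (ε :* i :- con (1 , 0)))
      refl a ε k i)) (*-pos 0<ε (0<y-x 2ai<k))

  geometric-small : ∀ a {ε} → 0# < ε → ∃ λ N → ∀ n → N ℕ.≤ n → a * h ^ n < ε
  geometric-small a {ε} 0<ε = N , λ n N≤n → archimedean-bound 0<ε (0<h^ n)
    (inv-inverseʳ ε ε#0) (<-weaken N≤n 2a/ε<N) (proj₂ (n*h^n n))
    where
    ε#0 : ε # 0#
    ε#0 = pos⇒#0 0<ε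
    N = proj₁ (archimedean (fromℕ 2 * a * inv ε ε#0))
    2a/ε<N = proj₂ (archimedean (fromℕ 2 * a * inv ε ε#0))

  geometric⟶0 : ∀ {u} a → (∀ n → Bounded (u n) (a * h ^ n)) → u ⟶ 0#
  geometric⟶0 {u} a bounded ε 0<ε = proj₁ small , λ n N≤n →
    Bounded⇒Within {ε} {u n} {0#} (Bounded-resp
      (solve 1 (λ u → u := u :- con (0 , 0)) refl (u n)) refl
      (Bounded-mono (proj₂ small n N≤n) (bounded n)))
    where small = geometric-small a 0<ε

  -- The Cauchy product

  -- A sequence `a` stands for the formal power series in t with coefficients `a m`, and `deriv` is
  -- d/dt. The coefficients `expTerm x` give the exponential of xt, so x appears as a factor of the
  -- derivative, and partial sums are evaluations at t = 1.
  shift deriv : (ℕ → Carrier) → ℕ → Carrier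
  shift a m = a (suc m)
  deriv a m = fromℕ (suc m) * a (suc m)

  conv : (ℕ → Carrier) → (ℕ → Carrier) → ℕ → Carrier
  conv a b zero    = a 0 * b 0
  conv a b (suc m) = a 0 * b (suc m) + conv (shift a) b m

  conv-cong : ∀ {a a′ b b′} → (∀ m → a m ≈ a′ m) → (∀ m → b m ≈ b′ m) →
    ∀ m → conv a b m ≈ conv a′ b′ m
  conv-cong p q zero    = *-cong (p 0) (q 0)
  conv-cong p q (suc m) = +-cong (*-cong (p 0) (q (suc m))) (conv-cong (λ k → p (suc k)) q m)

  conv-+ˡ : ∀ a a′ b m → conv (λ k → a k + a′ k) b m ≈ conv a b m + conv a′ b m
  conv-+ˡ a a′ b zero    = distribʳ (b 0) (a 0) (a′ 0)
  conv-+ˡ a a′ b (suc m) = trans (+-congˡ (conv-+ˡ (shift a) (shift a′) b m))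
    (solve 5 (λ x y z p q → (x :+ y) :* z :+ (p :+ q) := (x :* z :+ p) :+ (y :* z :+ q))
      refl (a 0) (a′ 0) (b (suc m)) _ _)

  conv-*ˡ : ∀ s a b m → conv (λ k → s * a k) b m ≈ s * conv a b m
  conv-*ˡ s a b zero    = *-assoc s (a 0) (b 0)
  conv-*ˡ s a b (suc m) = trans (+-congˡ (conv-*ˡ s (shift a) b m))
    (solve 4 (λ s x y p → (s :* x) :* y :+ s :* p := s :* (x :* y :+ p))
      refl s (a 0) (b (suc m)) _)

  conv-*ʳ : ∀ t a b m → conv a (λ k → t * b k) m ≈ t * conv a b m
  conv-*ʳ t a b zero    = solve 3 (λ t x y → x :* (t :* y) := t :* (x :* y)) refl t (a 0) (b 0)
  conv-*ʳ t a b (suc m) = trans (+-congˡ (conv-*ʳ t (shift a) b m))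
    (solve 4 (λ t x y p → x :* (t :* y) :+ t :* p := t :* (x :* y :+ p))
      refl t (a 0) (b (suc m)) _)

  -- Induction along `shift a`. Of the factor 1 + k in front of `conv (shift a) b`, the k copies
  -- form a derivative to which the induction hypothesis applies; the single copy left over combines
  -- with it because `deriv a (suc j)` is `shift (shift a) j + deriv (shift a) j`.
  leibniz : ∀ a b m → deriv (conv a b) m ≈ conv (deriv a) b m + conv a (deriv b) m
  leibniz a b zero = solve 4 (λ x x′ y y′ →
    (con (1 , 0) :+ con (0 , 0)) :* (x :* y′ :+ x′ :* y)
      := ((con (1 , 0) :+ con (0 , 0)) :* x′) :* y :+ x :* ((con (1 , 0) :+ con (0 , 0)) :* y′))
    refl (a 0) (a 1) (b 0) (b 1)
  leibniz a b (suc m) = begin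
    (1# + k) * (a 0 * b (suc (suc m)) + (a 1 * b (suc m) + R))
      ≈⟨ solve 5 (λ k x x′ y R′ → (con (1 , 0) :+ k) :* (x :* y :+ R′)
           := x :* ((con (1 , 0) :+ k) :* y) :+ R′ :+ k :* R′)
         refl k (a 0) (a 1) (b (suc (suc m))) (a 1 * b (suc m) + R) ⟩
    a 0 * deriv b (suc m) + (a 1 * b (suc m) + R) + k * conv (shift a) b (suc m)
      ≈⟨ +-congˡ (leibniz (shift a) b m) ⟩
    a 0 * deriv b (suc m) + (a 1 * b (suc m) + R) + (S + T)
      ≈⟨ solve 6 (λ x x′ y R S T → x :+ (x′ :* y :+ R) :+ (S :+ T)
           := (((con (1 , 0) :+ con (0 , 0)) :* x′) :* y :+ (R :+ S)) :+ (x :+ T))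
         refl (a 0 * deriv b (suc m)) (a 1) (b (suc m)) R S T ⟩
    (deriv a 0 * b (suc m) + (R + S)) + (a 0 * deriv b (suc m) + T)
      ≈⟨ +-congʳ (+-congˡ (trans (sym (conv-+ˡ (shift (shift a)) (deriv (shift a)) b m))
           (conv-cong (λ j → solve 2 (λ j x → x :+ j :* x := (con (1 , 0) :+ j) :* x) refl
             (fromℕ (suc j)) (a (suc (suc j)))) (λ _ → refl) m))) ⟩
    conv (deriv a) b (suc m) + conv a (deriv b) (suc m) ∎
    where
    k R S T : Carrier
    k = fromℕ (suc m)
    R = conv (shift (shift a)) b m
    S = conv (deriv (shift a)) b m
    T = conv (shift a) (deriv b) m

  partialSum-cong : ∀ {a b} → (∀ m → a m ≈ b m) → ∀ n → partialSum a n ≈ partialSum b n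
  partialSum-cong p zero    = refl
  partialSum-cong p (suc n) = +-cong (partialSum-cong p n) (p n)

  partialSum-+ : ∀ a b n → partialSum (λ m → a m + b m) n ≈ partialSum a n + partialSum b n
  partialSum-+ a b zero    = sym (+-identityʳ 0#)
  partialSum-+ a b (suc n) = trans (+-congʳ (partialSum-+ a b n))
    (solve 4 (λ x y p q → (x :+ y) :+ (p :+ q) := (x :+ p) :+ (y :+ q)) refl _ _ (a n) (b n))

  partialSum-neg : ∀ a n → partialSum (λ m → - a m) n ≈ - partialSum a n
  partialSum-neg a zero    = solve 0 (con (0 , 0) := :- con (0 , 0)) refl
  partialSum-neg a (suc n) = trans (+-congʳ (partialSum-neg a n))
    (solve 2 (λ x y → :- x :+ :- y := :- (x :+ y)) refl _ (a n))

  partialSum-front : ∀ a n → partialSum a (suc n) ≈ a 0 + partialSum (shift a) n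
  partialSum-front a zero    = +-comm 0# (a 0)
  partialSum-front a (suc n) = trans (+-congʳ (partialSum-front a n)) (+-assoc _ _ _)

  partialSum-conv : ∀ a b n → partialSum (conv a b) (suc n)
    ≈ a 0 * partialSum b (suc n) + partialSum (conv (shift a) b) n
  partialSum-conv a b zero    = solve 2 (λ x y →
    con (0 , 0) :+ x :* y := x :* (con (0 , 0) :+ y) :+ con (0 , 0)) refl (a 0) (b 0)
  partialSum-conv a b (suc n) = trans (+-congʳ (partialSum-conv a b n))
    (solve 5 (λ x s y p q → (x :* s :+ p) :+ (x :* y :+ q) := x :* (s :+ y) :+ (p :+ q))
      refl (a 0) (partialSum b (suc n)) (b (suc n)) _ _)

  shift-bounded : ∀ {a A} → (∀ m → Bounded (a m) (A * h ^ m)) →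
    ∀ m → Bounded (shift a m) ((A * h) * h ^ m)
  shift-bounded {A = A} bounded m =
    Bounded-resp refl (sym (*-assoc A h (h ^ m))) (bounded (suc m))

  -- Splitting off the first term keeps the constant exact: the shifted sequence has constant A/2,
  -- and A + 2(A/2) = 2A.
  partialSum-bounded : ∀ {a A} → (∀ m → Bounded (a m) (A * h ^ m)) →
    ∀ n → Bounded (partialSum a n) (A + A)
  partialSum-bounded {a} {A} bounded zero = Bounded-0 (+-pos 0<A 0<A)
    where
    0<A : 0# < A
    0<A = <-respʳ-≈ (*-identityʳ A) (bound-pos (bounded 0))
  partialSum-bounded {a} {A} bounded (suc n) = Bounded-resp (sym (partialSum-front a n))
    (modulo A h+h≈1 (solve 2 (λ A h → A :* con (1 , 0) :+ (A :* h :+ A :* h)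
      := (A :+ A) :+ A :* (h :+ h :- con (1 , 0))) refl A h))
    (Bounded-+ (bounded 0) (partialSum-bounded (shift-bounded {a} {A} bounded) n))

  -- The sum of `a j * b k` over j, k < n with j + k ≥ n: the square of indices without the triangle
  -- covered by the Cauchy product.
  cauchyError : (ℕ → Carrier) → (ℕ → Carrier) → ℕ → Carrier
  cauchyError a b n = partialSum a n * partialSum b n - partialSum (conv a b) n

  -- The row j = 0 has no entry with j + k ≥ n + 1. In the other rows, lowered by one, the column k
  -- = n gives the product and the columns k < n give the error for `shift a`.
  cauchyError-suc : ∀ a b n → cauchyError a b (suc n)
    ≈ partialSum (shift a) n * b n + cauchyError (shift a) b n
  cauchyError-suc a b n = trans
    (+-cong (*-congʳ (partialSum-front a n)) (-‿cong (partialSum-conv a b n)))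
    (solve 5 (λ x p s y c → (x :+ p) :* (s :+ y) :- (x :* (s :+ y) :+ c)
      := p :* y :+ (p :* s :- c)) refl (a 0) (partialSum (shift a) n) (partialSum b n) (b n) _)

  -- Passing to `shift a` turns A into A h, exactly the factor h by which the bound shrinks from n
  -- to n + 1; the new column adds one more copy of 2AB hⁿ⁺¹, whence the linear factor.
  cauchyError-bounded : ∀ {a b A B} →
    (∀ m → Bounded (a m) (A * h ^ m)) → (∀ m → Bounded (b m) (B * h ^ m)) →
    ∀ n → Bounded (cauchyError a b n) (fromℕ (suc n) * (fromℕ 2 * (A * B) * h ^ n))
  cauchyError-bounded {a} {b} {A} {B} p q zero = Bounded-resp
    (solve 0 (con (0 , 0) := con (0 , 0) :* con (0 , 0) :- con (0 , 0)) refl)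
    (solve 2 (λ A B → con (2 , 0) :* ((A :* con (1 , 0)) :* (B :* con (1 , 0)))
      := (con (1 , 0) :+ con (0 , 0)) :* (con (2 , 0) :* (A :* B) :* con (1 , 0))) refl A B)
    (Bounded-0 (*-pos (0<fromℕ 1) (*-pos (bound-pos (p 0)) (bound-pos (q 0)))))
  cauchyError-bounded {a} {b} {A} {B} p q (suc n) = Bounded-resp
    (sym (cauchyError-suc a b n))
    (solve 5 (λ A B h k x → (A :* h :+ A :* h) :* (B :* x) :+ k :* (con (2 , 0) :* ((A :* h) :* B) :* x)
      := (con (1 , 0) :+ k) :* (con (2 , 0) :* (A :* B) :* (h :* x)))
      refl A B h (fromℕ (suc n)) (h ^ n))
    (Bounded-+ (Bounded-* (partialSum-bounded p′ n) (q n))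
      (cauchyError-bounded p′ q n))
    where
    p′ : ∀ m → Bounded (shift a m) ((A * h) * h ^ m)
    p′ = shift-bounded {a} {A} p

  h^-+ : ∀ m n → h ^ (m ℕ.+ n) ≈ h ^ m * h ^ n
  h^-+ zero    n = sym (*-identityˡ (h ^ n))
  h^-+ (suc m) n = trans (*-congˡ (h^-+ m n)) (sym (*-assoc h (h ^ m) (h ^ n)))

  -- At even indices one half of the exponent absorbs the linear factor of the error bound, since (n
  -- + 1)hⁿ < 2, and the other half remains as a geometric bound.
  2n*h^2n : ∀ n → fromℕ (suc (2 ℕ.* n)) * h ^ (2 ℕ.* n) < fromℕ 4 * h ^ n
  2n*h^2n n = <-from (*-pos (0<h^ n) (+-pos (*-pos (0<fromℕ 1) (0<y-x (proj₂ (n*h^n n)))) (0<h^ n)))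
    (trans (+-congˡ (-‿cong (*-cong suc2n h^2n)))
      (solve 2 (λ x k → con (4 , 0) :* x :- (con (1 , 0) :+ con (2 , 0) :* k) :* (x :* x)
        := x :* (con (2 , 0) :* (con (2 , 0) :- (con (1 , 0) :+ k) :* x) :+ x))
        refl (h ^ n) (fromℕ n)))
    where
    suc2n : fromℕ (suc (2 ℕ.* n)) ≈ 1# + fromℕ 2 * fromℕ n
    suc2n = +-congˡ (×1-homo-* 2 n)
    h^2n : h ^ (2 ℕ.* n) ≈ h ^ n * h ^ n
    h^2n = trans (h^-+ n (n ℕ.+ 0)) (*-congˡ (reflexive (≡.cong (h ^_) (ℕ.+-identityʳ n))))

  cauchyError⟶0 : ∀ {a b A B} →
    (∀ m → Bounded (a m) (A * h ^ m)) → (∀ m → Bounded (b m) (B * h ^ m)) →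
    (λ n → cauchyError a b (2 ℕ.* n)) ⟶ 0#
  cauchyError⟶0 {a} {b} {A} {B} p q = geometric⟶0 (fromℕ 8 * (A * B)) λ n →
    Bounded-mono
      (<-from (*-pos 0<2AB (0<y-x (2n*h^2n n)))
        (solve 5 (λ A B x k y → con (8 , 0) :* (A :* B) :* x :- k :* (con (2 , 0) :* (A :* B) :* y)
          := con (2 , 0) :* (A :* B) :* (con (4 , 0) :* x :- k :* y))
          refl A B (h ^ n) (fromℕ (suc (2 ℕ.* n))) (h ^ (2 ℕ.* n))))
      (cauchyError-bounded p q (2 ℕ.* n))
    where
    0<2AB : 0# < fromℕ 2 * (A * B)
    0<2AB = <-respʳ-≈
      (solve 2 (λ A B → con (2 , 0) :* ((A :* con (1 , 0)) :* (B :* con (1 , 0)))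
        := con (2 , 0) :* (A :* B)) refl A B)
      (*-pos (0<fromℕ 1) (*-pos (bound-pos (p 0)) (bound-pos (q 0))))

  conv⟶ : ∀ {a b A B α β} →
    (∀ m → Bounded (a m) (A * h ^ m)) → (∀ m → Bounded (b m) (B * h ^ m)) →
    (λ n → partialSum a (2 ℕ.* n)) ⟶ α → (λ n → partialSum b (2 ℕ.* n)) ⟶ β →
    (λ n → partialSum (conv a b) (2 ℕ.* n)) ⟶ α * β
  conv⟶ {a} {b} {α = α} {β} p q a⟶α b⟶β = ⟶-cong
    (λ n → solve 3 (λ x y z → x :* y :+ :- (x :* y :- z) := z) refl
      (partialSum a (2 ℕ.* n)) (partialSum b (2 ℕ.* n)) (partialSum (conv a b) (2 ℕ.* n)))
    (solve 2 (λ α β → α :* β :+ :- con (0 , 0) := α :* β) refl α β)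
    (⟶-+ (⟶-* a⟶α b⟶β) (⟶-neg (cauchyError⟶0 {a} {b} p q)))

  -- The series of cos and sin

  fromℕ#0 : ∀ n .{{_ : ℕ.NonZero n}} → fromℕ n # 0#
  fromℕ#0 (suc n) = pos⇒#0 (0<fromℕ n)

  m!*expTerm : ∀ x m → fromℕ (m !) * expTerm x m ≈ x ^ m
  m!*expTerm x m = *-/ℕ (x ^ m) (m !) {{m ℕ.!≢0}}

  expTerm-suc : ∀ x m → deriv (expTerm x) m ≈ x * expTerm x m
  expTerm-suc x m = *-cancelˡ (fromℕ#0 (m !) {{m ℕ.!≢0}}) (begin
    f * (k * expTerm x (suc m))      ≈⟨ solve 3 (λ f k e → f :* (k :* e) := (k :* f) :* e) refl f k _ ⟩
    (k * f) * expTerm x (suc m)      ≈⟨ *-congʳ (×1-homo-* (suc m) (m !)) ⟨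
    fromℕ (suc m !) * expTerm x (suc m) ≈⟨ m!*expTerm x (suc m) ⟩
    x * x ^ m                        ≈⟨ *-congˡ (m!*expTerm x m) ⟨
    x * (f * expTerm x m)            ≈⟨ solve 3 (λ f x e → x :* (f :* e) := f :* (x :* e)) refl f x _ ⟩
    f * (x * expTerm x m) ∎)
    where
    f k : Carrier
    f = fromℕ (m !)
    k = fromℕ (suc m)

  -- `cosTerm` and `sinTerm` list only one parity of degrees. Here the zeros are restored, so that
  -- index and degree agree as the Cauchy product requires.
  cosCoeff sinCoeff : ℕ → Carrier
  cosCoeff zero    = 1#
  cosCoeff (suc m) = - sinCoeff m
  sinCoeff zero    = 0#
  sinCoeff (suc m) = cosCoeff m

  cosSeries sinSeries : Carrier → ℕ → Carrier
  cosSeries x m = cosCoeff m * expTerm x m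
  sinSeries x m = sinCoeff m * expTerm x m

  -- The formal initial value problem C′ = - x S, S′ = x C, C 0 = 1, S 0 = 0.
  record TrigSeries (x : Carrier) (C S : ℕ → Carrier) : Set ℓ₁ where
    field
      cos0 : C 0 ≈ 1#
      sin0 : S 0 ≈ 0#
      cos′ : ∀ m → deriv C m ≈ - x * S m
      sin′ : ∀ m → deriv S m ≈ x * C m

  open TrigSeries

  trigSeries : ∀ x → TrigSeries x (cosSeries x) (sinSeries x)
  trigSeries x = record
    { cos0 = trans (*-identityˡ _) (trans (*-comm 1# _)
        (trans (*-congˡ (sym (+-identityʳ 1#))) (trans (*-comm _ _) (inv-inverseʳ (fromℕ 1) _))))
    ; sin0 = solve 1 (λ e → con (0 , 0) :* e := con (0 , 0)) refl _
    ; cos′ = λ m → trans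
        (solve 3 (λ k s e → k :* (:- s :* e) := :- s :* (k :* e)) refl (fromℕ (suc m)) (sinCoeff m) _)
        (trans (*-congˡ (expTerm-suc x m))
          (solve 3 (λ s x e → :- s :* (x :* e) := :- x :* (s :* e)) refl (sinCoeff m) x _))
    ; sin′ = λ m → trans
        (solve 3 (λ k s e → k :* (s :* e) := s :* (k :* e)) refl (fromℕ (suc m)) (cosCoeff m) _)
        (trans (*-congˡ (expTerm-suc x m))
          (solve 3 (λ s x e → s :* (x :* e) := x :* (s :* e)) refl (cosCoeff m) x _))
    }

  -- Each equation fixes the next coefficient up to the invertible factor m + 1. The two series are
  -- compared together because each recurrence refers to the other.
  trigSeries-unique : ∀ {x C S C′ S′} → TrigSeries x C S → TrigSeries x C′ S′ →
    ∀ m → C m ≈ C′ m × S m ≈ S′ m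
  trigSeries-unique t t′ zero =
    trans (cos0 t) (sym (cos0 t′)) , trans (sin0 t) (sym (sin0 t′))
  trigSeries-unique t t′ (suc m) =
      *-cancelˡ (fromℕ#0 (suc m))
        (trans (cos′ t m) (trans (*-congˡ (proj₂ ih)) (sym (cos′ t′ m))))
    , *-cancelˡ (fromℕ#0 (suc m))
        (trans (sin′ t m) (trans (*-congˡ (proj₁ ih)) (sym (sin′ t′ m))))
    where ih = trigSeries-unique t t′ m

  trigSeries-cong : ∀ {x y C S} → x ≈ y → TrigSeries x C S → TrigSeries y C S
  trigSeries-cong x≈y t = record
    { cos0 = cos0 t
    ; sin0 = sin0 t
    ; cos′ = λ m → trans (cos′ t m) (*-congʳ (-‿cong x≈y))
    ; sin′ = λ m → trans (sin′ t m) (*-congʳ x≈y)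
    }

  trigSeries-neg : ∀ {x C S} → TrigSeries x C S → TrigSeries (- x) C (λ m → - S m)
  trigSeries-neg {x} {C} {S} t = record
    { cos0 = cos0 t
    ; sin0 = trans (-‿cong (sin0 t)) (solve 0 (:- con (0 , 0) := con (0 , 0)) refl)
    ; cos′ = λ m → trans (cos′ t m)
        (solve 2 (λ x s → :- x :* s := :- (:- x) :* (:- s)) refl x (S m))
    ; sin′ = λ m → trans (solve 2 (λ k s → k :* (:- s) := :- (k :* s)) refl (fromℕ (suc m)) (S (suc m)))
        (trans (-‿cong (sin′ t m)) (solve 2 (λ x s → :- (x :* s) := :- x :* s) refl x (C m)))
    }

  deriv-conv : ∀ {a a′ b b′ s t} →
    (∀ m → deriv a m ≈ s * a′ m) → (∀ m → deriv b m ≈ t * b′ m) →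
    ∀ m → deriv (conv a b) m ≈ s * conv a′ b m + t * conv a b′ m
  deriv-conv {a} {a′} {b} {b′} {s} {t} p q m = trans (leibniz a b m) (+-cong
    (trans (conv-cong p (λ _ → refl) m) (conv-*ˡ s a′ b m))
    (trans (conv-cong (λ _ → refl) q m) (conv-*ʳ t a b′ m)))

  trigSeries-+ : ∀ {x y C S C′ S′} → TrigSeries x C S → TrigSeries y C′ S′ →
    TrigSeries (x + y) (λ m → conv C C′ m + - conv S S′ m) (λ m → conv S C′ m + conv C S′ m)
  trigSeries-+ {x} {y} {C} {S} {C′} {S′} t t′ = record
    { cos0 = trans (+-cong (*-cong (cos0 t) (cos0 t′)) (-‿cong (*-cong (sin0 t) (sin0 t′))))
        (solve 0 (con (1 , 0) :* con (1 , 0) :+ :- (con (0 , 0) :* con (0 , 0)) := con (1 , 0)) refl)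
    ; sin0 = trans (+-cong (*-cong (sin0 t) (cos0 t′)) (*-cong (cos0 t) (sin0 t′)))
        (solve 0 (con (0 , 0) :* con (1 , 0) :+ con (1 , 0) :* con (0 , 0) := con (0 , 0)) refl)
    ; cos′ = λ m → trans
        (solve 3 (λ k p q → k :* (p :+ :- q) := k :* p :+ :- (k :* q)) refl (fromℕ (suc m)) _ _)
        (trans (+-cong (deriv-conv (cos′ t) (cos′ t′) m) (-‿cong (deriv-conv (sin′ t) (sin′ t′) m)))
          (solve 4 (λ x y p q → (:- x :* p :+ :- y :* q) :+ :- (x :* q :+ y :* p)
            := :- (x :+ y) :* (p :+ q)) refl x y (conv S C′ m) (conv C S′ m)))
    ; sin′ = λ m → trans (distribˡ (fromℕ (suc m)) _ _)
        (trans (+-cong (deriv-conv (sin′ t) (cos′ t′) m) (deriv-conv (cos′ t) (sin′ t′) m))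
          (solve 4 (λ x y p q → (x :* p :+ :- y :* q) :+ (:- x :* q :+ y :* p)
            := (x :+ y) :* (p :+ :- q)) refl x y (conv C C′ m) (conv S S′ m)))
    }

  coeff-bounded : ∀ m {x a} → Bounded x a →
    Bounded (cosCoeff m * x) a × Bounded (sinCoeff m * x) a
  coeff-bounded zero {x} b =
      Bounded-resp (sym (*-identityˡ x)) refl b
    , Bounded-resp (solve 1 (λ x → con (0 , 0) := con (0 , 0) :* x) refl x) refl
        (Bounded-0 (bound-pos b))
  coeff-bounded (suc m) {x} b =
      Bounded-resp (solve 2 (λ s x → :- (s :* x) := :- s :* x) refl (sinCoeff m) x) refl
        (Bounded-neg (proj₂ (coeff-bounded m b)))
    , proj₁ (coeff-bounded m b)

  cosSeries-bounded : ∀ x m → Bounded (cosSeries x m) (termBound x * h ^ m)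
  cosSeries-bounded x m = proj₁ (coeff-bounded m (expTerm-bounded x m))

  sinSeries-bounded : ∀ x m → Bounded (sinSeries x m) (termBound x * h ^ m)
  sinSeries-bounded x m = proj₂ (coeff-bounded m (expTerm-bounded x m))

  coeff-even : ∀ n → cosCoeff (2 ℕ.* n) ≈ (- 1#) ^ n × sinCoeff (2 ℕ.* n) ≈ 0#
  coeff-even zero = refl , refl
  coeff-even (suc n) =
      trans (reflexive (≡.cong cosCoeff (ℕ.*-suc 2 n)))
        (trans (-‿cong (proj₁ (coeff-even n)))
          (solve 1 (λ s → :- s := (:- con (1 , 0)) :* s) refl ((- 1#) ^ n)))
    , trans (reflexive (≡.cong sinCoeff (ℕ.*-suc 2 n)))
        (trans (-‿cong (proj₂ (coeff-even n))) (solve 0 (:- con (0 , 0) := con (0 , 0)) refl))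

  partialSum-2* : ∀ a n → partialSum a (2 ℕ.* suc n)
    ≈ partialSum a (2 ℕ.* n) + a (2 ℕ.* n) + a (suc (2 ℕ.* n))
  partialSum-2* a n = reflexive (≡.cong (partialSum a) (ℕ.*-suc 2 n))

  -- Terms are added in pairs: the one of odd degree is zero and the other is the next `cosTerm`.
  partialSum-cosSeries : ∀ x n → partialSum (cosSeries x) (2 ℕ.* n) ≈ partialSum (cosTerm x) n
  partialSum-cosSeries x zero    = refl
  partialSum-cosSeries x (suc n) = trans (partialSum-2* (cosSeries x) n) (trans
    (+-cong (+-cong (partialSum-cosSeries x n) (*-congʳ (proj₁ (coeff-even n))))
            (*-congʳ (-‿cong (proj₂ (coeff-even n)))))
    (solve 2 (λ p e → p :+ (:- con (0 , 0)) :* e := p) refl _ _))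

  partialSum-sinSeries : ∀ x n → partialSum (sinSeries x) (2 ℕ.* n) ≈ partialSum (sinTerm x) n
  partialSum-sinSeries x zero    = refl
  partialSum-sinSeries x (suc n) = trans (partialSum-2* (sinSeries x) n) (trans
    (+-cong (+-cong (partialSum-sinSeries x n) (*-congʳ (proj₂ (coeff-even n))))
            (*-congʳ (proj₁ (coeff-even n))))
    (solve 3 (λ p e q → (p :+ con (0 , 0) :* e) :+ q := p :+ q) refl _ _ _))

  -- These variables are instantiated with cos and sin, whose unfolding would make
  -- conversion checking explode.
  module SumsOfSeries
    (cos sin : Carrier → Carrier)
    (cos-limit : ∀ x → partialSum (cosTerm x) ⟶ cos x)
    (sin-limit : ∀ x → partialSum (sinTerm x) ⟶ sin x)
    where

    -- Functional equations of `cos` and `sin`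

    cosSeries⟶cos : ∀ x → (λ n → partialSum (cosSeries x) (2 ℕ.* n)) ⟶ cos x
    cosSeries⟶cos x = ⟶-cong (λ n → sym (partialSum-cosSeries x n)) refl (cos-limit x)

    sinSeries⟶sin : ∀ x → (λ n → partialSum (sinSeries x) (2 ℕ.* n)) ⟶ sin x
    sinSeries⟶sin x = ⟶-cong (λ n → sym (partialSum-sinSeries x n)) refl (sin-limit x)

    trigSeries⟶ : ∀ {x C S} → TrigSeries x C S →
      (λ n → partialSum C (2 ℕ.* n)) ⟶ cos x × (λ n → partialSum S (2 ℕ.* n)) ⟶ sin x
    trigSeries⟶ {x} t =
        ⟶-cong (λ n → partialSum-cong (λ m → proj₁ (unique m)) (2 ℕ.* n)) refl (cosSeries⟶cos x)
      , ⟶-cong (λ n → partialSum-cong (λ m → proj₂ (unique m)) (2 ℕ.* n)) refl (sinSeries⟶sin x)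
      where unique = trigSeries-unique (trigSeries x) t

    -- Turns identities for `cos` into algebra: any solution of the initial value problem at `x` has
    -- the coefficients of the standard series, so it suffices to find the limit of its partial sums
    -- in another way.
    cos-unique : ∀ {x C S l} → TrigSeries x C S →
      (λ n → partialSum C (2 ℕ.* n)) ⟶ l → cos x ≈ l
    cos-unique t C⟶l = ⟶-unique (proj₁ (trigSeries⟶ t)) C⟶l

    sin-unique : ∀ {x C S l} → TrigSeries x C S →
      (λ n → partialSum S (2 ℕ.* n)) ⟶ l → sin x ≈ l
    sin-unique t S⟶l = ⟶-unique (proj₂ (trigSeries⟶ t)) S⟶l

    -- Not automatic: `complete` is not assumed to respect `_≈_`, so congruence has to come from
    -- uniqueness of the series and of limits.
    cos-cong : ∀ {x y} → x ≈ y → cos x ≈ cos y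
    cos-cong {x} {y} x≈y = cos-unique (trigSeries-cong (sym x≈y) (trigSeries y)) (cosSeries⟶cos y)

    sin-cong : ∀ {x y} → x ≈ y → sin x ≈ sin y
    sin-cong {x} {y} x≈y = sin-unique (trigSeries-cong (sym x≈y) (trigSeries y)) (sinSeries⟶sin y)

    cos-neg : ∀ x → cos (- x) ≈ cos x
    cos-neg x = cos-unique (trigSeries-neg (trigSeries x)) (cosSeries⟶cos x)

    sin-neg : ∀ x → sin (- x) ≈ - sin x
    sin-neg x = sin-unique (trigSeries-neg (trigSeries x))
      (⟶-cong (λ n → sym (partialSum-neg (sinSeries x) (2 ℕ.* n))) refl
        (⟶-neg (sinSeries⟶sin x)))

    cos-+ : ∀ x y → cos (x + y) ≈ cos x * cos y + - (sin x * sin y)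
    cos-+ x y = cos-unique (trigSeries-+ (trigSeries x) (trigSeries y))
      (⟶-cong (λ n → sym (trans (partialSum-+ (conv (cosSeries x) (cosSeries y)) _ (2 ℕ.* n))
          (+-congˡ (partialSum-neg (conv (sinSeries x) (sinSeries y)) (2 ℕ.* n))))) refl
        (⟶-+
          (conv⟶
            (cosSeries-bounded x) (cosSeries-bounded y) (cosSeries⟶cos x) (cosSeries⟶cos y))
          (⟶-neg (conv⟶
            (sinSeries-bounded x) (sinSeries-bounded y) (sinSeries⟶sin x) (sinSeries⟶sin y)))))

    sin-+ : ∀ x y → sin (x + y) ≈ sin x * cos y + cos x * sin y
    sin-+ x y = sin-unique (trigSeries-+ (trigSeries x) (trigSeries y))
      (⟶-cong (λ n → sym (partialSum-+ (conv (sinSeries x) (cosSeries y))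
          (conv (cosSeries x) (sinSeries y)) (2 ℕ.* n))) refl
        (⟶-+
          (conv⟶
            (sinSeries-bounded x) (cosSeries-bounded y) (sinSeries⟶sin x) (cosSeries⟶cos y))
          (conv⟶
            (cosSeries-bounded x) (sinSeries-bounded y) (cosSeries⟶cos x) (sinSeries⟶sin y))))

    cos-diff : ∀ x y → cos (x - y) ≈ cos x * cos y + sin x * sin y
    cos-diff x y = trans (cos-+ x (- y)) (trans
      (+-cong (*-congˡ (cos-neg y)) (-‿cong (*-congˡ (sin-neg y))))
      (solve 4 (λ c d s t → c :* d :+ :- (s :* (:- t)) := c :* d :+ s :* t)
        refl (cos x) (cos y) (sin x) (sin y)))

    sin-diff : ∀ x y → sin (x - y) ≈ sin x * cos y - cos x * sin y
    sin-diff x y = trans (sin-+ x (- y)) (trans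
      (+-cong (*-congˡ (cos-neg y)) (*-congˡ (sin-neg y)))
      (solve 4 (λ c d s t → s :* d :+ c :* (:- t) := s :* d :- c :* t)
        refl (cos x) (cos y) (sin x) (sin y)))

    expTerm-0 : ∀ m → expTerm 0# (suc m) ≈ 0#
    expTerm-0 m = *-cancelˡ (fromℕ#0 (suc m)) (trans (expTerm-suc 0# m)
      (solve 2 (λ k e → con (0 , 0) :* e := k :* con (0 , 0)) refl (fromℕ (suc m)) (expTerm 0# m)))

    cos-0 : cos 0# ≈ 1#
    cos-0 = ⟶-unique (⟶-suc (cos-limit 0#)) (⟶-cong (λ n → sym (sums n)) refl (⟶-const 1#))
      where
      sums : ∀ n → partialSum (cosTerm 0#) (suc n) ≈ 1#
      sums zero    = trans (+-identityˡ _) (cos0 (trigSeries 0#))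
      -- `2 * suc n` computes to the successor of `n + 1 * suc n`, so the added term has positive
      -- degree and vanishes at 0.
      sums (suc n) = trans (+-cong (sums n) (*-congˡ (expTerm-0 (n ℕ.+ 1 ℕ.* suc n))))
        (solve 1 (λ s → con (1 , 0) :+ s :* con (0 , 0) := con (1 , 0)) refl ((- 1#) ^ suc n))

    sin²+cos² : ∀ x → sin x * sin x + cos x * cos x ≈ 1#
    sin²+cos² x = trans (+-comm _ _) (trans (sym (cos-diff x x)) (trans (cos-cong (-‿inverseʳ x)) cos-0))

    -- Estimates

    Bounded-÷ : ∀ k {x a} → Bounded (fromℕ (suc k) * x) a → Bounded x a
    Bounded-÷ zero {x} b = Bounded-resp
      (solve 1 (λ x → (con (1 , 0) :+ con (0 , 0)) :* x := x) refl x) refl b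
    Bounded-÷ (suc k) {x} {a} b = Bounded-resp
      (trans (sym (*-assoc i n x)) (trans (*-congʳ (trans (*-comm i n) (inv-inverseʳ n n#0)))
        (*-identityˡ x)))
      refl (Bounded-mono (<-from (*-pos 0<i (*-pos (0<fromℕ k) (bound-pos b)))
        (modulo (- a) (inv-inverseʳ n n#0) (solve 3 (λ i k a →
          a :- i :* a := i :* (k :* a) :+ (:- a) :* ((con (1 , 0) :+ k) :* i :- con (1 , 0)))
          refl i (fromℕ (suc k)) a)))
        (Bounded-scale 0<i b))
      where
      n = fromℕ (suc (suc k))
      n#0 = fromℕ#0 (suc (suc k))
      i = inv n n#0
      0<i : 0# < i
      0<i = inv-pos n#0 (0<fromℕ (suc k))

    expTerm-suc-bounded : ∀ m {x ε a} → Bounded x ε → Bounded (expTerm x m) a →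
      Bounded (expTerm x (suc m)) (ε * a)
    expTerm-suc-bounded m {x} p q =
      Bounded-÷ m (Bounded-resp (sym (expTerm-suc x m)) refl (Bounded-* p q))

    expTerm-zero : ∀ x → expTerm x 0 ≈ 1#
    expTerm-zero x = trans (sym (*-identityˡ (expTerm x 0))) (cos0 (trigSeries x))

    expTerm-one : ∀ x → expTerm x 1 ≈ x
    expTerm-one x = *-cancelˡ (fromℕ#0 1) (trans (expTerm-suc x 0)
      (trans (*-congˡ (expTerm-zero x))
        (solve 1 (λ x → x :* con (1 , 0) := (con (1 , 0) :+ con (0 , 0)) :* x) refl x)))

    expTerm-small : ∀ m {x ε} → Bounded x ε → ε < h →
      Bounded (expTerm x (suc (suc m))) ((ε * ε) * h ^ m)
    expTerm-small zero {x} {ε} b ε<h = Bounded-resp refl (sym (*-identityʳ (ε * ε)))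
      (expTerm-suc-bounded 1 b (Bounded-resp (sym (expTerm-one x)) refl b))
    expTerm-small (suc m) {x} {ε} b ε<h = Bounded-mono
      (<-from (*-pos (0<y-x ε<h) (*-pos (*-pos (bound-pos b) (bound-pos b)) (0<h^ m)))
        (solve 3 (λ ε h p → (ε :* ε) :* (h :* p) :- ε :* ((ε :* ε) :* p) := (h :- ε) :* ((ε :* ε) :* p))
          refl ε h (h ^ m)))
      (expTerm-suc-bounded (suc (suc m)) b (expTerm-small m b ε<h))

    -- The degree is 2k + 3, so `expTerm-small` gives ε² h²ᵏ⁺¹; k factors h are given up to reach
    -- the geometric form that `partialSum-bounded` expects.
    sinTerm-small : ∀ k {x ε} → Bounded x ε → ε < h →
      Bounded (sinTerm x (suc k)) (((ε * ε) * h) * h ^ k)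
    sinTerm-small k {x} {ε} b ε<h = Bounded-resp refl
      (trans (*-congˡ (reflexive (≡.cong (λ j → h ^ suc j) (ℕ.+-identityʳ k))))
        (sym (*-assoc (ε * ε) h (h ^ k))))
      (Bounded-sign (suc k) (Bounded-drop k (suc (k ℕ.+ 0)) (expTerm-small (k ℕ.+ suc (k ℕ.+ 0)) b ε<h)))

    -- Beyond the linear term the partial sums stay below ε²h + ε²h = ε²; the second ε² is the slack
    -- needed in the limit.
    sin-x-bounded : ∀ {x ε} → Bounded x ε → ε < h → Bounded (sin x - x) (ε * ε + ε * ε)
    sin-x-bounded {x} {ε} b ε<h = ⟶-bounded {λ n → partialSum (sinTerm x) (suc n) + - x}
      (⟶-+ (⟶-suc (sin-limit x)) (⟶-const (- x)))
      (λ n → Bounded-resp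
        (sym (trans (+-congʳ (trans (partialSum-front (sinTerm x) n) (+-congʳ
            (trans (*-identityˡ (expTerm x 1)) (expTerm-one x)))))
          (solve 2 (λ x s → (x :+ s) :+ :- x := s) refl x (partialSum (shift (sinTerm x)) n))))
        (modulo (ε * ε) h+h≈1 (solve 2 (λ ε h → (ε :* ε) :* h :+ (ε :* ε) :* h
          := ε :* ε :+ (ε :* ε) :* (h :+ h :- con (1 , 0))) refl ε h))
        (partialSum-bounded {shift (sinTerm x)} (λ k → sinTerm-small k b ε<h) n))
      (<-from (*-pos (bound-pos b) (bound-pos b))
        (solve 1 (λ e → (e :+ e) :- e := e) refl (ε * ε)))

    sin-small : ∀ {x ε} → Bounded x ε → ε < h → Bounded (sin x) (ε + ε)
    sin-small {x} {ε} b ε<h = Bounded-resp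
      (solve 2 (λ s x → (s :- x) :+ x := s) refl (sin x) x) refl
      (Bounded-mono
        (<-from (*-pos (bound-pos b) (+-pos (0<y-x ε<h) (0<y-x ε<h)))
          (modulo (- ε) h+h≈1 (solve 2 (λ ε h → (ε :+ ε) :- ((ε :* ε :+ ε :* ε) :+ ε)
            := ε :* ((h :- ε) :+ (h :- ε)) :+ (:- ε) :* (h :+ h :- con (1 , 0))) refl ε h)))
        (Bounded-+ (sin-x-bounded b ε<h) b))

    -- sin x > x - 8 x².
    sin-pos-small : ∀ {x} → 0# < x → x < h ^ 3 → 0# < sin x
    sin-pos-small {x} 0<x x<h³ = <-from
      (+-pos (0<y-x (proj₂ (sin-x-bounded {x} {x + x} |x|<2x 2x<h)))
             (*-pos (*-pos (0<fromℕ 7) 0<x) (0<y-x x<h³)))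
      (modulo (- x * (fromℕ 4 * h * h + fromℕ 2 * h + 1#)) h+h≈1 (solve 3 (λ s x h →
        s :- con (0 , 0) := (((x :+ x) :* (x :+ x) :+ (x :+ x) :* (x :+ x)) :- (:- (s :- x))
            :+ con (8 , 0) :* x :* (h :* (h :* (h :* con (1 , 0))) :- x))
          :+ (:- x) :* (con (4 , 0) :* h :* h :+ con (2 , 0) :* h :+ con (1 , 0)) :* (h :+ h :- con (1 , 0)))
        refl (sin x) x h))
      where
      -- A strict bound on |x| must exceed x; with 2x the error is 2(2x)² = 8x², which explains the
      -- threshold h³ = 1/8.
      |x|<2x : Bounded x (x + x)
      |x|<2x = Bounded-pos 0<x (<-from 0<x (solve 1 (λ x → (x :+ x) :- x := x) refl x))
      2x<h : x + x < h
      2x<h = <-from (+-pos (+-pos (0<y-x x<h³) (0<y-x x<h³)) (*-pos 0<h 0<h))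
        (modulo (- (h * h + h)) h+h≈1 (solve 2 (λ x h →
          h :- (x :+ x) := (((h :* (h :* (h :* con (1 , 0))) :- x) :+ (h :* (h :* (h :* con (1 , 0))) :- x))
              :+ h :* h)
            :+ (:- (h :* h :+ h)) :* (h :+ h :- con (1 , 0))) refl x h))

    -- The equation gives only x ≤ 1, while `Bounded` is strict. Cotransitivity at 1 < 2 leaves the
    -- case 1 < x, in which y² = 1 - x² would be negative.
    circle⇒<2 : ∀ {x y} → x * x + y * y ≈ 1# → x < fromℕ 2
    circle⇒<2 {x} {y} e with <-cotrans 1<2 x
      where
      1<2 : 1# < fromℕ 2
      1<2 = <-from 0<1 (solve 0 (con (2 , 0) :- con (1 , 0) := con (1 , 0)) refl)
    ... | inj₂ x<2 = x<2
    ... | inj₁ 1<x = ⊥-elim (square-≥0 y (<-from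
      (+-pos (*-pos (0<y-x 1<x) (0<y-x 1<x)) (*-pos (0<fromℕ 1) (0<y-x 1<x)))
      (modulo (- 1#) e (solve 2 (λ x y → con (0 , 0) :- y :* y
        := ((x :- con (1 , 0)) :* (x :- con (1 , 0)) :+ con (2 , 0) :* (x :- con (1 , 0)))
           :+ (:- con (1 , 0)) :* (x :* x :+ y :* y :- con (1 , 0))) refl x y))))

    sin-bounded : ∀ x → Bounded (sin x) (fromℕ 2)
    sin-bounded x = circle⇒<2 (sin²+cos² x) , circle⇒<2 (trans
      (+-congʳ (solve 1 (λ s → (:- s) :* (:- s) := s :* s) refl (sin x))) (sin²+cos² x))

    cos-bounded : ∀ x → Bounded (cos x) (fromℕ 2)
    cos-bounded x = circle⇒<2 (trans (+-comm _ _) (sin²+cos² x)) , circle⇒<2 (trans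
      (trans (+-congʳ (solve 1 (λ s → (:- s) :* (:- s) := s :* s) refl (cos x))) (+-comm _ _)) (sin²+cos² x))

    half+half : ∀ x → h * x + h * x ≈ x
    half+half x = modulo x h+h≈1 (solve 2 (λ h x →
      h :* x :+ h :* x := x :+ x :* (h :+ h :- con (1 , 0))) refl h x)

    -- cos (m + s) - cos (m - s) = - 2 sin m sin s with m = x + t / 2 and s = t / 2.
    cos-lipschitz : ∀ x {t ε} → Bounded t ε → ε < h → Bounded (cos (x + t) - cos x) (fromℕ 4 * ε)
    cos-lipschitz x {t} {ε} b ε<h = Bounded-resp
      (sym (trans (+-cong
          (trans (cos-cong (trans (+-congˡ (sym (half+half t))) (sym (+-assoc x s s)))) (cos-+ m s))
          (-‿cong (trans (cos-cong (solve 2 (λ x s → x := (x :+ s) :- s) refl x s)) (cos-diff m s))))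
        (solve 4 (λ c d p q → (c :* d :+ :- (p :* q)) :- (c :* d :+ p :* q) := :- (p :* (q :+ q)))
          refl (cos m) (cos s) (sin m) (sin s))))
      (modulo (fromℕ 4 * ε) h+h≈1 (solve 2 (λ ε h →
        con (2 , 0) :* ((h :* ε :+ h :* ε) :+ (h :* ε :+ h :* ε))
          := con (4 , 0) :* ε :+ con (4 , 0) :* ε :* (h :+ h :- con (1 , 0))) refl ε h))
      (Bounded-neg (Bounded-* (sin-bounded m) (Bounded-+ |sin-s| |sin-s|)))
      where
      s = h * t
      m = x + s
      0<ε = bound-pos b
      hε<h : h * ε < h
      hε<h = <-trans (<-from (*-pos 0<h 0<ε) (modulo (- ε) h+h≈1 (solve 2 (λ h ε →
        ε :- h :* ε := h :* ε :+ (:- ε) :* (h :+ h :- con (1 , 0))) refl h ε))) ε<h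
      |sin-s| : Bounded (sin s) (h * ε + h * ε)
      |sin-s| = sin-small (Bounded-scale 0<h b) hε<h

    -- Continuity at `x`: with ε = a/8 the Lipschitz constant 4 yields a/2, and `a < 2` ensures the
    -- condition ε < h of the Lipschitz estimate.
    cos-near : ∀ x {a} → 0# < a → a < fromℕ 2 → ∃ λ ε → 0# < ε ×
      (∀ t → Bounded t ε → Bounded (cos (x + t) - cos x) a)
    cos-near x {a} 0<a a<2 = ε , 0<ε , λ t b → Bounded-mono
      (<-from (*-pos 0<h 0<a) (modulo (- a * (fromℕ 2 * h * h + h + 1#)) h+h≈1 (solve 2 (λ a h →
        a :- con (4 , 0) :* (h :* (h :* (h :* a))) := h :* a
          :+ (:- a) :* (con (2 , 0) :* h :* h :+ h :+ con (1 , 0)) :* (h :+ h :- con (1 , 0))) refl a h)))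
      (cos-lipschitz x b ε<h)
      where
      ε = h * (h * (h * a))
      0<ε : 0# < ε
      0<ε = *-pos 0<h (*-pos 0<h (*-pos 0<h 0<a))
      ε<h : ε < h
      ε<h = <-from (+-pos (*-pos 0<h 0<h) (*-pos 0<h (*-pos 0<h (*-pos 0<h (0<y-x a<2)))))
        (modulo (- (h + h * h)) h+h≈1 (solve 2 (λ a h →
          h :- h :* (h :* (h :* a)) := (h :* h :+ h :* (h :* (h :* (con (2 , 0) :- a))))
            :+ (:- (h :+ h :* h)) :* (h :+ h :- con (1 , 0))) refl a h))

    -- Bisection

    -- The width after n halvings is t/2ⁿ whichever halves are chosen, so only the left end is
    -- stored. The range conditions are weak because the first bracket is [0, t] itself.
    record Bracket (t : Carrier) (n : ℕ) : Set (c ⊔ ℓ₃) where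
      field
        left      : Carrier
        0≤left    : 0# ≤ left
        right≤t   : left + t * h ^ n ≤ t
        0<cosleft : 0# < cos left
        cosright<0 : cos (left + t * h ^ n) < 0#

    open Bracket

    ≤-respˡ-≈ : ∀ {x y z} → x ≈ y → x ≤ z → y ≤ z
    ≤-respˡ-≈ x≈y x≤z z<y = x≤z (<-respʳ-≈ (sym x≈y) z<y)

    x<x+p : ∀ {x p} → 0# < p → x < x + p
    x<x+p {x} {p} 0<p = <-from 0<p (solve 2 (λ x p → (x :+ p) :- x := p) refl x p)

    module _ {b : Carrier} (cos#0 : ∀ t → 0# < t → t < b → cos t # 0#) where

      -- The midpoint lies strictly between 0 and b, so `cos#0` decides its sign. The left end moves
      -- by 0 or by half the width, hence by less than the width, which makes the left ends a Cauchy
      -- sequence.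
      bisect : ∀ {t} → 0# < t → t < b → ∀ n (B : Bracket t n) →
        ∃ λ (B′ : Bracket t (suc n)) → Bounded (left B′ - left B) (t * h ^ n)
      bisect {t} 0<t t<b n B = choose (#⇒<⊎> (cos#0 m 0<m (<-trans m<t t<b)))
        where
        l d m : Carrier
        l = left B
        d = t * h ^ suc n
        m = l + d
        0<d : 0# < d
        0<d = *-pos 0<t (0<h^ (suc n))
        d+d : m + d ≈ l + t * h ^ n
        d+d = modulo (t * h ^ n) h+h≈1 (solve 4 (λ l t h p →
          (l :+ t :* (h :* p)) :+ t :* (h :* p)
            := (l :+ t :* p) :+ t :* p :* (h :+ h :- con (1 , 0))) refl l t h (h ^ n))
        0<m : 0# < m
        0<m = ≤-<-trans (0≤left B) (x<x+p 0<d)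
        m<t : m < t
        m<t = <-≤-trans (x<x+p 0<d) (≤-respˡ-≈ (sym d+d) (right≤t B))
        d<2d : d < t * h ^ n
        d<2d = <-from 0<d (modulo (- (t * h ^ n)) h+h≈1 (solve 3 (λ t h p →
          t :* p :- t :* (h :* p) := t :* (h :* p) :+ (:- (t :* p)) :* (h :+ h :- con (1 , 0)))
          refl t h (h ^ n)))
        choose : cos m < 0# ⊎ 0# < cos m →
          ∃ λ (B′ : Bracket t (suc n)) → Bounded (left B′ - left B) (t * h ^ n)
        choose (inj₁ cosm<0) = record
          { left = l ; 0≤left = 0≤left B ; right≤t = <-asym m<t
          ; 0<cosleft = 0<cosleft B ; cosright<0 = cosm<0 }
          , Bounded-resp (sym (-‿inverseʳ l)) refl (Bounded-0 (<-trans 0<d d<2d))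
        choose (inj₂ 0<cosm) = record
          { left = m ; 0≤left = <-asym 0<m ; right≤t = ≤-respˡ-≈ (sym d+d) (right≤t B)
          ; 0<cosleft = 0<cosm ; cosright<0 = <-respˡ-≈ (cos-cong (sym d+d)) (cosright<0 B) }
          , Bounded-resp (solve 2 (λ l d → d := (l :+ d) :- l) refl l d) refl (Bounded-pos 0<d d<2d)

      -- The left ends converge to some x in [0, t], and every sign of cos x is absurd: by
      -- continuity a negative value contradicts a left end and a positive value a right end, while
      -- zero contradicts `cos#0`, or cos 0 = 1 when x is 0.
      no-sign-change : ∀ {t} → 0# < t → t < b → ¬ (cos t < 0#)
      no-sign-change {t} 0<t t<b cost<0 = trichotomy-⊥ ¬cosx<0 ¬cosx≈0 ¬0<cosx
        where
        brackets : ∀ n → Bracket t n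
        brackets zero = record
          { left = 0# ; 0≤left = <-irrefl refl
          ; right≤t = λ t<0+t → <-irrefl (sym 0+t*1) t<0+t
          ; 0<cosleft = <-respʳ-≈ (sym cos-0) 0<1
          ; cosright<0 = <-respˡ-≈ (cos-cong (sym 0+t*1)) cost<0 }
          where
          0+t*1 : 0# + t * 1# ≈ t
          0+t*1 = trans (+-identityˡ _) (*-identityʳ t)
        brackets (suc n) = proj₁ (bisect 0<t t<b n (brackets n))

        u : ℕ → Carrier
        u n = left (brackets n)

        limit : ∃ λ x → u ⟶ x
        limit = complete u (geometric-cauchy u t λ n → proj₂ (bisect 0<t t<b n (brackets n)))

        x : Carrier
        x = proj₁ limit

        0≤x : 0# ≤ x
        0≤x = ⟶-≤ (⟶-const 0#) (proj₂ limit) λ n → 0≤left (brackets n)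

        x≤t : x ≤ t
        x≤t = ⟶-≤ (proj₂ limit) (⟶-const t) λ n →
          <-asym (<-≤-trans (x<x+p (*-pos 0<t (0<h^ n))) (right≤t (brackets n)))

        ¬cosx≈0 : ¬ (cos x ≈ 0#)
        ¬cosx≈0 cosx≈0 = trichotomy-⊥ 0≤x′ x≉0 0≤x
          where
          0≤x′ : ¬ (0# < x)
          0≤x′ 0<x = proj₂ (tight _ _) cosx≈0 (cos#0 x 0<x (≤-<-trans x≤t t<b))
          x≉0 : ¬ (0# ≈ x)
          x≉0 0≈x = <-irrefl (trans (sym cosx≈0) (trans (cos-cong (sym 0≈x)) cos-0)) 0<1

        ¬cosx<0 : ¬ (cos x < 0#)
        ¬cosx<0 cosx<0 = <-asym (0<cosleft (brackets n)) (<-from (0<y-x (proj₁ |Δ|))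
          (sym (trans (+-congˡ (-‿cong (+-congʳ (cos-cong (x+l-x (u n))))))
            (solve 2 (λ p q → (:- q) :- (p :- q) := con (0 , 0) :- p) refl (cos (u n)) (cos x)))))
          where
          near : ∃ λ ε → 0# < ε × (∀ s → Bounded s ε → Bounded (cos (x + s) - cos x) (- cos x))
          near = cos-near x (neg-pos cosx<0) (proj₂ (cos-bounded x))
          close = proj₂ limit (proj₁ near) (proj₁ (proj₂ near))
          n = proj₁ close
          x+l-x : ∀ l → x + (l - x) ≈ l
          x+l-x l = solve 2 (λ x l → x :+ (l :- x) := l) refl x l
          |Δ| : Bounded (cos (x + (u n - x)) - cos x) (- cos x)
          |Δ| = proj₂ (proj₂ near) (u n - x) (Within⇒Bounded (proj₂ close n ℕ.≤-refl))

        ¬0<cosx : ¬ (0# < cos x)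
        ¬0<cosx 0<cosx = <-asym (cosright<0 (brackets n)) (<-from (0<y-x (proj₂ |Δ|))
          (sym (trans (+-congˡ (-‿cong (-‿cong (+-congʳ (cos-cong (x+s (u n) (t * h ^ n)))))))
            (solve 2 (λ p q → q :- (:- (p :- q)) := p :- con (0 , 0)) refl (cos (u n + t * h ^ n)) (cos x)))))
          where
          near : ∃ λ ε → 0# < ε × (∀ s → Bounded s ε → Bounded (cos (x + s) - cos x) (cos x))
          near = cos-near x 0<cosx (proj₁ (cos-bounded x))
          -- The right end differs from x by `u n - x` plus the width of the bracket; each may use
          -- half of the radius.
          δ = h * proj₁ near
          0<δ : 0# < δ
          0<δ = *-pos 0<h (proj₁ (proj₂ near))
          close = proj₂ limit δ 0<δ
          small = geometric-small t 0<δ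
          n = proj₁ close ℕ.+ proj₁ small
          x+s : ∀ l d → x + ((l - x) + d) ≈ l + d
          x+s l d = solve 3 (λ x l d → x :+ ((l :- x) :+ d) := l :+ d) refl x l d
          |Δ| : Bounded (cos (x + ((u n - x) + t * h ^ n)) - cos x) (cos x)
          |Δ| = proj₂ (proj₂ near) ((u n - x) + t * h ^ n) (Bounded-resp refl (half+half (proj₁ near))
            (Bounded-+ (Within⇒Bounded (proj₂ close n (ℕ.m≤m+n _ _)))
              (Bounded-pos (*-pos 0<t (0<h^ n)) (proj₂ small n (ℕ.m≤n+m _ _)))))

    -- Signs of `cos` and `sin` below π/2 and their values at multiples of π/4

    sin-double : ∀ x → sin (x + x) ≈ fromℕ 2 * sin x * cos x
    sin-double x = trans (sin-+ x x) (solve 2 (λ s c → s :* c :+ c :* s := con (2 , 0) :* s :* c)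
      refl (sin x) (cos x))

    *#0⇒#0ʳ : ∀ {x y} → x * y # 0# → y # 0#
    *#0⇒#0ʳ {x} {y} xy#0 = invertibleˡ⇒# (inv (x * y) xy#0 * x , modulo 1# (inv-inverseʳ (x * y) xy#0)
      (solve 3 (λ i x y → i :* x :* (y :- con (0 , 0))
        := con (1 , 0) :+ con (1 , 0) :* (x :* y :* i :- con (1 , 0))) refl (inv (x * y) xy#0) x y))

    *-cancel-pos : ∀ {x y} → 0# < y → 0# < x * y → 0# < x
    *-cancel-pos {x} {y} 0<y 0<xy = <-respʳ-≈ (modulo x (inv-inverseʳ y (pos⇒#0 0<y))
        (solve 3 (λ x y i → x :* y :* i := x :+ x :* (y :* i :- con (1 , 0)))
          refl x y (inv y (pos⇒#0 0<y))))
      (*-pos 0<xy (inv-pos (pos⇒#0 0<y) 0<y))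

    -- With q = π/4 as the basic quantity, π/2 and π become sums of copies of q, which the ring
    -- solver handles without division.
    module QuarterOfPi
      (q : Carrier) (0<q : 0# < q) (sin4q≈0 : sin ((q + q) + (q + q)) ≈ 0#)
      (sin#0 : ∀ t → 0# < t → t < (q + q) + (q + q) → sin t # 0#) where

      2q 4q : Carrier
      2q = q + q
      4q = 2q + 2q

      0<2q : 0# < 2q
      0<2q = +-pos 0<q 0<q

      q<2q : q < 2q
      q<2q = x<x+p 0<q

      2q<4q : 2q < 4q
      2q<4q = x<x+p 0<2q

      cos#0 : ∀ t → 0# < t → t < 2q → cos t # 0#
      cos#0 t 0<t t<2q = *#0⇒#0ʳ (#-congʳ (sin-double t) (sin#0 (t + t) (+-pos 0<t 0<t)
        (<-from (+-pos (0<y-x t<2q) (0<y-x t<2q))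
          (solve 2 (λ t q → (q :+ q) :- (t :+ t) := (q :- t) :+ (q :- t)) refl t 2q))))

      -- The sign of t cannot be decided, so a case distinction on it can only refute cos t < 0.
      -- Strictness comes from `cos t # 0`, which `IsArctan` supplies at the values of arctan.
      cos-pos : ∀ {t} → Bounded t 2q → cos t # 0# → 0# < cos t
      cos-pos {t} (t<2q , -t<2q) cost#0 = #∧≤⇒< (#-sym cost#0) λ cost<0 → trichotomy-⊥
        (λ t<0 → no-sign-change cos#0 (neg-pos t<0) -t<2q (<-respˡ-≈ (sym (cos-neg t)) cost<0))
        (λ t≈0 → <-asym cost<0 (<-respʳ-≈ (sym (trans (cos-cong t≈0) cos-0)) 0<1))
        (λ 0<t → no-sign-change cos#0 0<t t<2q cost<0)

      0<cosq : 0# < cos q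
      0<cosq = cos-pos (Bounded-pos 0<q q<2q) (cos#0 q 0<q q<2q)

      -- In 0 = sin 4q = 2 sin 2q cos 2q the factor sin 2q is apart from 0, because 2q lies below
      -- the least positive zero.
      cos2q≈0 : cos 2q ≈ 0#
      cos2q≈0 = *-cancelˡ (x#0y#0→xy#0 (fromℕ#0 2) (sin#0 2q 0<2q 2q<4q))
        (trans (sym (sin-double 2q)) (trans sin4q≈0
          (solve 1 (λ s → con (0 , 0) := con (2 , 0) :* s :* con (0 , 0)) refl (sin 2q))))

      -- Halving t preserves sin t < 0, but sin is positive near 0.
      sin-≥0 : ∀ {t} → 0# < t → t < 2q → 0# ≤ sin t
      sin-≥0 {t} 0<t t<2q sint<0 =
        <-asym (halves n) (sin-pos-small (*-pos 0<t (0<h^ n)) (proj₂ small n ℕ.≤-refl))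
        where
        small = geometric-small t (0<h^ 3)
        n = proj₁ small
        th^-pos : ∀ k → 0# < t * h ^ k
        th^-pos k = *-pos 0<t (0<h^ k)
        double : ∀ k → t * h ^ suc k + t * h ^ suc k ≈ t * h ^ k
        double k = modulo (t * h ^ k) h+h≈1 (solve 3 (λ t h p →
          t :* (h :* p) :+ t :* (h :* p) := t :* p :+ t :* p :* (h :+ h :- con (1 , 0))) refl t h (h ^ k))
        th^<2q : ∀ k → t * h ^ k < 2q
        th^<2q zero    = <-respˡ-≈ (sym (*-identityʳ t)) t<2q
        th^<2q (suc k) = <-trans (<-respʳ-≈ (double k) (x<x+p (th^-pos (suc k)))) (th^<2q k)
        halves : ∀ k → sin (t * h ^ k) < 0#
        halves zero    = <-respˡ-≈ (sin-cong (sym (*-identityʳ t))) sint<0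
        halves (suc k) = #∧≤⇒< (sin#0 s (th^-pos (suc k)) (<-trans (th^<2q (suc k)) 2q<4q))
          λ 0<sins → <-asym (halves k) (<-respʳ-≈
            (trans (sym (sin-double s)) (sin-cong (double k)))
            (*-pos (*-pos (0<fromℕ 1) 0<sins)
              (cos-pos (Bounded-pos (th^-pos (suc k)) (th^<2q (suc k)))
                (cos#0 s (th^-pos (suc k)) (th^<2q (suc k))))))
          where s = t * h ^ suc k

      -- The product (sin q + cos q)(cos q - sin q) is cos 2q = 0, and its first factor is positive.
      sinq≈cosq : sin q ≈ cos q
      sinq≈cosq = sym (begin
        cos q                     ≈⟨ solve 2 (λ c s → c := (c :- s) :+ s) refl (cos q) (sin q) ⟩
        (cos q - sin q) + sin q   ≈⟨ +-congʳ (*-cancelˡ (pos⇒#0 0<sum)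
          (trans (solve 2 (λ c s → (s :+ c) :* (c :- s) := c :* c :+ :- (s :* s)) refl (cos q) (sin q))
          (trans (sym (cos-+ q q)) (trans cos2q≈0
          (solve 1 (λ x → con (0 , 0) := x :* con (0 , 0)) refl (sin q + cos q)))))) ⟩
        0# + sin q                ≈⟨ +-identityˡ (sin q) ⟩
        sin q ∎)
        where
        0<sum : 0# < sin q + cos q
        0<sum = ≤-<-trans (sin-≥0 0<q q<2q) (x<x+p 0<cosq)

      -- For c = cos x, c² = 1 gives (1 + c)c = 1 + c, and 1 + c is invertible.
      cos≈1 : ∀ {x} → sin x ≈ 0# → 0# < cos x → cos x ≈ 1#
      cos≈1 {x} sinx≈0 0<cosx = *-cancelˡ (pos⇒#0 (+-pos 0<1 0<cosx)) (begin
        (1# + C) * C            ≈⟨ solve 1 (λ c → (con (1 , 0) :+ c) :* c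
                                     := (con (0 , 0) :* con (0 , 0) :+ c :* c) :+ c) refl C ⟩
        (0# * 0# + C * C) + C   ≈⟨ +-congʳ (trans (+-congʳ (*-cong (sym sinx≈0) (sym sinx≈0))) (sin²+cos² x)) ⟩
        1# + C                  ≈⟨ *-identityʳ (1# + C) ⟨
        (1# + C) * 1# ∎)
        where C = cos x

      -- Here cos x = 1 - 2 sin² (x / 2) = 1, and |x / 2| < π.
      unique-zero : ∀ {x} → Bounded x (4q + 4q) → sin x ≈ 0# → 0# < cos x → x ≈ 0#
      unique-zero {x} bounded sinx≈0 0<cosx = ≤-antisym
        (λ 0<x → proj₂ (tight _ _) siny≈0 (sin#0 y (*-pos 0<h 0<x) (proj₁ |y|)))
        (λ x<0 → proj₂ (tight _ _)
          (trans (sin-neg y) (trans (-‿cong siny≈0) (solve 0 (:- con (0 , 0) := con (0 , 0)) refl)))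
          (sin#0 (- y) (<-respʳ-≈ (solve 2 (λ h x → h :* (:- x) := :- (h :* x)) refl h x)
            (*-pos 0<h (neg-pos x<0))) (proj₂ |y|)))
        where
        y = h * x
        |y| : Bounded y 4q
        |y| = Bounded-resp refl (trans (distribˡ h 4q 4q) (half+half 4q)) (Bounded-scale 0<h bounded)
        siny≈0 : sin y ≈ 0#
        siny≈0 = square≈0⇒≈0 (*-cancelˡ (fromℕ#0 2) (begin
          fromℕ 2 * (s * s)
            ≈⟨ solve 2 (λ c s → con (2 , 0) :* (s :* s) := (s :* s :+ c :* c) :- (c :* c :+ :- (s :* s)))
                 refl (cos y) s ⟩
          (s * s + cos y * cos y) - (cos y * cos y + - (s * s))
            ≈⟨ +-cong (sin²+cos² y) (-‿cong (trans (sym (cos-+ y y))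
                 (trans (cos-cong (half+half x)) (cos≈1 sinx≈0 0<cosx)))) ⟩
          1# - 1#
            ≈⟨ solve 0 (con (1 , 0) :- con (1 , 0) := con (2 , 0) :* con (0 , 0)) refl ⟩
          fromℕ 2 * 0# ∎))
          where s = sin y

      -- For i = tan a and r = tan b, the equation for r is tan (2a + b) = 1.
      module _ {a b i r : Carrier}
        (|a|<2q : Bounded a 2q) (|b|<2q : Bounded b 2q)
        (cosa#0 : cos a # 0#) (cosb#0 : cos b # 0#)
        (sina≈ : sin a ≈ i * cos a) (sinb≈ : sin b ≈ r * cos b)
        (0<i : 0# < i) (i<2 : i < fromℕ 2)
        (r≈ : r * (1# + fromℕ 2 * i - i * i) ≈ 1# - fromℕ 2 * i - i * i) where

        θ k : Carrier
        θ = (a + a) + b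
        k = cos a * cos a * cos b

        sinθ≈ : sin θ ≈ k * (fromℕ 2 * i + (1# - i * i) * r)
        sinθ≈ = begin
          sin θ ≈⟨ sin-+ (a + a) b ⟩
          sin (a + a) * cos b + cos (a + a) * sin b
            ≈⟨ +-cong (*-congʳ (trans (sin-+ a a) (+-cong (*-congʳ sina≈) (*-congˡ sina≈))))
                 (*-cong (trans (cos-+ a a) (+-congˡ (-‿cong (*-cong sina≈ sina≈)))) sinb≈) ⟩
          (i * cos a * cos a + cos a * (i * cos a)) * cos b
            + (cos a * cos a + - (i * cos a * (i * cos a))) * (r * cos b)
            ≈⟨ solve 4 (λ c d i r →
                 (i :* c :* c :+ c :* (i :* c)) :* d :+ (c :* c :+ :- (i :* c :* (i :* c))) :* (r :* d)
                   := c :* c :* d :* (con (2 , 0) :* i :+ (con (1 , 0) :- i :* i) :* r))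
                 refl (cos a) (cos b) i r ⟩
          k * (fromℕ 2 * i + (1# - i * i) * r) ∎

        cosθ≈ : cos θ ≈ k * ((1# - i * i) - fromℕ 2 * i * r)
        cosθ≈ = begin
          cos θ ≈⟨ cos-+ (a + a) b ⟩
          cos (a + a) * cos b + - (sin (a + a) * sin b)
            ≈⟨ +-cong (*-congʳ (trans (cos-+ a a) (+-congˡ (-‿cong (*-cong sina≈ sina≈)))))
                 (-‿cong (*-cong (trans (sin-+ a a) (+-cong (*-congʳ sina≈) (*-congˡ sina≈))) sinb≈)) ⟩
          (cos a * cos a + - (i * cos a * (i * cos a))) * cos b
            + - ((i * cos a * cos a + cos a * (i * cos a)) * (r * cos b))
            ≈⟨ solve 4 (λ c d i r →
                 (c :* c :+ :- (i :* c :* (i :* c))) :* d :+ :- ((i :* c :* c :+ c :* (i :* c)) :* (r :* d))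
                   := c :* c :* d :* ((con (1 , 0) :- i :* i) :- con (2 , 0) :* i :* r))
                 refl (cos a) (cos b) i r ⟩
          k * ((1# - i * i) - fromℕ 2 * i * r) ∎

        sinθ≈cosθ : sin θ ≈ cos θ
        sinθ≈cosθ = begin
          sin θ ≈⟨ sinθ≈ ⟩
          k * (fromℕ 2 * i + (1# - i * i) * r)
            -- Regrouped so that r occurs in the product r(1 + 2i - i²), which `r≈` can replace.
            ≈⟨ solve 3 (λ k i r → k :* (con (2 , 0) :* i :+ (con (1 , 0) :- i :* i) :* r)
                 := k :* ((con (2 , 0) :* i :- con (2 , 0) :* i :* r)
                      :+ r :* (con (1 , 0) :+ con (2 , 0) :* i :- i :* i))) refl k i r ⟩
          k * ((fromℕ 2 * i - fromℕ 2 * i * r) + r * (1# + fromℕ 2 * i - i * i))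
            ≈⟨ *-congˡ (+-congˡ r≈) ⟩
          k * ((fromℕ 2 * i - fromℕ 2 * i * r) + (1# - fromℕ 2 * i - i * i))
            ≈⟨ solve 3 (λ k i r → k :* ((con (2 , 0) :* i :- con (2 , 0) :* i :* r)
                    :+ (con (1 , 0) :- con (2 , 0) :* i :- i :* i))
                 := k :* ((con (1 , 0) :- i :* i) :- con (2 , 0) :* i :* r)) refl k i r ⟩
          k * ((1# - i * i) - fromℕ 2 * i * r) ≈⟨ cosθ≈ ⟨
          cos θ ∎

        -- cos θ (1 + 2i - i²) = cos² a cos b (1 + i²)².
        0<cosθ : 0# < cos θ
        0<cosθ = *-cancel-pos {y = d} 0<d (<-respʳ-≈ (sym (begin
          cos θ * d ≈⟨ *-congʳ cosθ≈ ⟩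
          k * ((1# - i * i) - fromℕ 2 * i * r) * d
            ≈⟨ solve 4 (λ k i r d → k :* ((con (1 , 0) :- i :* i) :- con (2 , 0) :* i :* r) :* d
                 := k :* ((con (1 , 0) :- i :* i) :* d :- con (2 , 0) :* i :* (r :* d))) refl k i r d ⟩
          k * ((1# - i * i) * d - fromℕ 2 * i * (r * d))
            ≈⟨ *-congˡ (+-congˡ (-‿cong (*-congˡ r≈))) ⟩
          k * ((1# - i * i) * d - fromℕ 2 * i * (1# - fromℕ 2 * i - i * i))
            ≈⟨ solve 2 (λ k i → k :* ((con (1 , 0) :- i :* i) :* (con (1 , 0) :+ con (2 , 0) :* i :- i :* i)
                    :- con (2 , 0) :* i :* (con (1 , 0) :- con (2 , 0) :* i :- i :* i))
                 := k :* ((con (1 , 0) :+ i :* i) :* (con (1 , 0) :+ i :* i))) refl k i ⟩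
          k * ((1# + i * i) * (1# + i * i)) ∎))
          (*-pos 0<k (*-pos 0<1+i² 0<1+i²)))
          where
          d = 1# + fromℕ 2 * i - i * i
          0<d : 0# < d
          0<d = <-respʳ-≈ (solve 1 (λ i → con (1 , 0) :+ i :* (con (2 , 0) :- i)
              := con (1 , 0) :+ con (2 , 0) :* i :- i :* i) refl i)
            (+-pos 0<1 (*-pos 0<i (0<y-x i<2)))
          0<k : 0# < k
          0<k = *-pos (*-pos (cos-pos |a|<2q cosa#0) (cos-pos |a|<2q cosa#0)) (cos-pos |b|<2q cosb#0)
          0<1+i² : 0# < 1# + i * i
          0<1+i² = +-pos 0<1 (*-pos 0<i 0<i)

        quarter≈ : q ≈ θ
        quarter≈ = begin
          q              ≈⟨ solve 2 (λ q θ → q := θ :- (θ :- q)) refl q θ ⟩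
          θ - (θ - q)    ≈⟨ +-congˡ (-‿cong (unique-zero bounded
            (trans (sin-diff θ q) (trans (+-cong (*-congʳ sinθ≈cosθ) (-‿cong (*-congˡ sinq≈cosq)))
              (-‿inverseʳ (cos θ * cos q))))
            (<-respʳ-≈ (sym (trans (cos-diff θ q) (+-congˡ (*-cong sinθ≈cosθ sinq≈cosq))))
              (+-pos (*-pos 0<cosθ 0<cosq) (*-pos 0<cosθ 0<cosq))))) ⟩
          θ - 0#         ≈⟨ solve 1 (λ θ → θ :- con (0 , 0) := θ) refl θ ⟩
          θ ∎
          where
          -- Two copies of a, one of b and one of q, each below 2q in absolute value, add up to 8q =
          -- 2π, the range of `unique-zero`.
          bounded : Bounded (θ - q) (4q + 4q)
          bounded = Bounded-resp refl
            (solve 1 (λ q → ((q :+ q) :+ (q :+ q)) :+ (q :+ q) :+ (q :+ q)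
            := ((q :+ q) :+ (q :+ q)) :+ ((q :+ q) :+ (q :+ q))) refl q)
            (Bounded-+ (Bounded-+ (Bounded-+ |a|<2q |a|<2q) |b|<2q) (Bounded-neg (Bounded-pos 0<q q<2q)))

    -- The condition of `IsArctan π arctan` at the single point `x`, with `a` for the value; `tan`
    -- is written out because `cos` and `sin` are variables here.
    IsArctanOf : Carrier → Carrier → Carrier → Set (ℓ₁ ⊔ ℓ₂ ⊔ ℓ₃)
    IsArctanOf π x a = - (π /ℕ 2) < a × a < π /ℕ 2 ×
      Σ[ cos#0 ∈ cos a # 0# ] sin a / cos a [ cos#0 ] ≈ x

    arctan-identity : ∀ {π a b i r} →
      0# < π → sin π ≈ 0# → (∀ t → 0# < t → t < π → sin t # 0#) →
      IsArctanOf π i a → IsArctanOf π r b → 0# < i → i < fromℕ 2 →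
      r * (1# + fromℕ 2 * i - i * i) ≈ 1# - fromℕ 2 * i - i * i →
      π /ℕ 4 ≈ fromℕ 2 * a + b
    arctan-identity {π} {a} {b} {i} {r} 0<π sinπ≈0 sin#0
      (-π/2<a , a<π/2 , cosa#0 , tana≈) (-π/2<b , b<π/2 , cosb#0 , tanb≈) 0<i i<2 r≈ =
      trans (quarter≈ (bounded -π/2<a a<π/2) (bounded -π/2<b b<π/2) cosa#0 cosb#0
          (tan≈ a cosa#0 tana≈) (tan≈ b cosb#0 tanb≈) 0<i i<2 r≈)
        (+-congʳ (solve 1 (λ a → a :+ a := con (2 , 0) :* a) refl a))
      where
      q : Carrier
      q = π /ℕ 4
      4q≈π : (q + q) + (q + q) ≈ π
      4q≈π = trans (solve 1 (λ q → (q :+ q) :+ (q :+ q) := con (4 , 0) :* q) refl q) (*-/ℕ π 4)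
      2q≈π/2 : q + q ≈ π /ℕ 2
      2q≈π/2 = *-cancelˡ (fromℕ#0 2) (trans
        (solve 1 (λ q → con (2 , 0) :* (q :+ q) := (q :+ q) :+ (q :+ q)) refl q)
        (trans 4q≈π (sym (*-/ℕ π 2))))
      open QuarterOfPi q (/ℕ-pos 4 0<π) (trans (sin-cong 4q≈π) sinπ≈0)
        (λ t 0<t t<4q → sin#0 t 0<t (<-respʳ-≈ 4q≈π t<4q))
      bounded : ∀ {y} → - (π /ℕ 2) < y → y < π /ℕ 2 → Bounded y (q + q)
      bounded {y} -π/2<y y<π/2 = <-respʳ-≈ (sym 2q≈π/2) y<π/2 , <-respʳ-≈ (sym 2q≈π/2)
        (<-from (0<y-x -π/2<y) (solve 2 (λ y p → p :- (:- y) := y :- (:- p)) refl y (π /ℕ 2)))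
      tan≈ : ∀ y {x} (cosy#0 : cos y # 0#) → sin y / cos y [ cosy#0 ] ≈ x → sin y ≈ x * cos y
      tan≈ y cosy#0 e = trans (modulo (- sin y) (inv-inverseʳ (cos y) cosy#0)
        (solve 3 (λ s c i → s := s :* i :* c :+ (:- s) :* (c :* i :- con (1 , 0))) refl
          (sin y) (cos y) (inv (cos y) cosy#0))) (*-congʳ e)

  -- Lucas numbers

  φ²≈φ+1 : φ * φ ≈ φ + 1#
  φ²≈φ+1 = *-cancelˡ (fromℕ#0 4) (begin
    fromℕ 4 * (φ * φ)
      ≈⟨ solve 1 (λ f → con (4 , 0) :* (f :* f) := (con (2 , 0) :* f) :* (con (2 , 0) :* f)) refl φ ⟩
    (fromℕ 2 * φ) * (fromℕ 2 * φ) ≈⟨ *-cong 2φ≈ 2φ≈ ⟩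
    (1# + √5) * (1# + √5)
      ≈⟨ solve 1 (λ s → (con (1 , 0) :+ s) :* (con (1 , 0) :+ s)
           := con (1 , 0) :+ con (2 , 0) :* s :+ s :* s) refl √5 ⟩
    1# + fromℕ 2 * √5 + √5 * √5   ≈⟨ +-congˡ (proj₂ (proj₂ sqrt5)) ⟩
    1# + fromℕ 2 * √5 + fromℕ 5
      ≈⟨ solve 1 (λ s → con (1 , 0) :+ con (2 , 0) :* s :+ con (5 , 0)
           := con (2 , 0) :* (con (1 , 0) :+ s) :+ con (4 , 0)) refl √5 ⟩
    fromℕ 2 * (1# + √5) + fromℕ 4 ≈⟨ +-congʳ (*-congˡ 2φ≈) ⟨
    fromℕ 2 * (fromℕ 2 * φ) + fromℕ 4
      ≈⟨ solve 1 (λ f → con (2 , 0) :* (con (2 , 0) :* f) :+ con (4 , 0)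
           := con (4 , 0) :* (f :+ con (1 , 0))) refl φ ⟩
    fromℕ 4 * (φ + 1#) ∎)
    where
    2φ≈ : fromℕ 2 * φ ≈ 1# + √5
    2φ≈ = *-/ℕ (1# + √5) 2

  module Binet (f : Carrier) (f²≈f+1 : f * f ≈ f + 1#) where

    -- The conjugate root (1 - √5)/2 when f is the Golden mean.
    g : Carrier
    g = 1# - f

    f+g : f + g ≈ 1#
    f+g = solve 1 (λ f → f :+ (con (1 , 0) :- f) := con (1 , 0)) refl f

    fg≈-1 : f * g ≈ - 1#
    fg≈-1 = trans (solve 1 (λ f → f :* (con (1 , 0) :- f) := f :- f :* f) refl f)
      (trans (+-congˡ (-‿cong f²≈f+1))
        (solve 1 (λ f → f :- (f :+ con (1 , 0)) := :- con (1 , 0)) refl f))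

    g²≈g+1 : g * g ≈ g + 1#
    g²≈g+1 = trans (solve 1 (λ f → (con (1 , 0) :- f) :* (con (1 , 0) :- f)
        := con (1 , 0) :- con (2 , 0) :* f :+ f :* f) refl f)
      (trans (+-congˡ f²≈f+1) (solve 1 (λ f → con (1 , 0) :- con (2 , 0) :* f :+ (f :+ con (1 , 0))
        := (con (1 , 0) :- f) :+ con (1 , 0)) refl f))

    ^-suc² : ∀ {x} m → x * x ≈ x + 1# → x ^ suc (suc m) ≈ x ^ suc m + x ^ m
    ^-suc² {x} m e = trans (sym (*-assoc x x (x ^ m))) (trans (*-congʳ e)
      (solve 2 (λ x p → (x :+ con (1 , 0)) :* p := x :* p :+ p) refl x (x ^ m)))

    -- Consecutive indices are treated together since the recurrence reaches back two steps; powers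
    -- of both roots of x² = x + 1 satisfy it.
    binet : ∀ m → fromℕ (L m) ≈ f ^ m + g ^ m × fromℕ (L (suc m)) ≈ f ^ suc m + g ^ suc m
    binet zero = solve 0 (con (2 , 0) := con (1 , 0) :+ con (1 , 0)) refl
      , trans (+-identityʳ 1#) (trans (sym f+g) (+-cong (sym (*-identityʳ f)) (sym (*-identityʳ g))))
    binet (suc m) = proj₂ ih
      , trans (×-homo-+ 1# (L (suc m)) (L m)) (trans (+-cong (proj₂ ih) (proj₁ ih))
          (trans (solve 4 (λ a b c d → (a :+ b) :+ (c :+ d) := (a :+ c) :+ (b :+ d))
              refl (f ^ suc m) (g ^ suc m) (f ^ m) (g ^ m))
            (sym (+-cong (^-suc² m f²≈f+1) (^-suc² m g²≈g+1)))))
      where ih = binet m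

    f^g^-even : ∀ k → f ^ (2 ℕ.* k) * g ^ (2 ℕ.* k) ≈ 1#
    f^g^-even zero    = *-identityˡ 1#
    f^g^-even (suc k) = trans
      (*-cong (reflexive (≡.cong (f ^_) (ℕ.*-suc 2 k))) (reflexive (≡.cong (g ^_) (ℕ.*-suc 2 k))))
      (trans (solve 4 (λ f g p q → (f :* (f :* p)) :* (g :* (g :* q)) := (f :* g) :* (f :* g) :* (p :* q))
          refl f g (f ^ (2 ℕ.* k)) (g ^ (2 ℕ.* k)))
        (trans (*-cong (*-cong fg≈-1 fg≈-1) (f^g^-even k))
          (solve 0 ((:- con (1 , 0)) :* (:- con (1 , 0)) :* con (1 , 0) := con (1 , 0)) refl)))

    lucas-even : ∀ k → fromℕ (L (2 ℕ.* k)) * f ^ (2 ℕ.* k) ≈ f ^ (2 ℕ.* k) * f ^ (2 ℕ.* k) + 1#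
    lucas-even k = trans (*-congʳ (proj₁ (binet (2 ℕ.* k)))) (trans
      (solve 2 (λ p q → (p :+ q) :* p := p :* p :+ p :* q) refl (f ^ (2 ℕ.* k)) (g ^ (2 ℕ.* k)))
      (+-congˡ (f^g^-even k)))

  -- The second argument of arctan in terms of i = 1/p

  module _ {p l i : Carrier} (pi≈1 : p * i ≈ 1#) (lp≈ : l * p ≈ p * p + 1#) where

    -- By `lp≈` the second factor is p² + 2p - 1, and scaling by i² = 1/p² reverses its
    -- coefficients.
    denominator≈ : i * i * (- fromℕ 2 + (l + fromℕ 2) * p) ≈ 1# + fromℕ 2 * i - i * i
    denominator≈ = trans
      (solve 3 (λ p l i → i :* i :* (:- con (2 , 0) :+ (l :+ con (2 , 0)) :* p)
        := i :* i :* ((con (2 , 0) :* p :- con (2 , 0)) :+ l :* p)) refl p l i)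
      (trans (*-congˡ (+-congˡ lp≈))
        -- The cofactor collects p²i² - 1 = (pi + 1)(pi - 1) and 2pi² - 2i = 2i(pi - 1).
        (modulo (p * i + 1# + fromℕ 2 * i) pi≈1 (solve 2 (λ p i →
          i :* i :* ((con (2 , 0) :* p :- con (2 , 0)) :+ (p :* p :+ con (1 , 0)))
            := (con (1 , 0) :+ con (2 , 0) :* i :- i :* i)
               :+ (p :* i :+ con (1 , 0) :+ con (2 , 0) :* i) :* (p :* i :- con (1 , 0))) refl p i)))

    numerator≈ : i * i * (- fromℕ 2 + (l - fromℕ 2) * p) ≈ 1# - fromℕ 2 * i - i * i
    numerator≈ = trans
      (solve 3 (λ p l i → i :* i :* (:- con (2 , 0) :+ (l :- con (2 , 0)) :* p)
        := i :* i :* ((:- (con (2 , 0) :* p) :- con (2 , 0)) :+ l :* p)) refl p l i)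
      (trans (*-congˡ (+-congˡ lp≈))
        (modulo (p * i + 1# - fromℕ 2 * i) pi≈1 (solve 2 (λ p i →
          i :* i :* ((:- (con (2 , 0) :* p) :- con (2 , 0)) :+ (p :* p :+ con (1 , 0)))
            := (con (1 , 0) :- con (2 , 0) :* i :- i :* i)
               :+ (p :* i :+ con (1 , 0) :- con (2 , 0) :* i) :* (p :* i :- con (1 , 0))) refl p i)))

    quotient≈ : (d#0 : - fromℕ 2 + (l + fromℕ 2) * p # 0#) →
      (- fromℕ 2 + (l - fromℕ 2) * p) / (- fromℕ 2 + (l + fromℕ 2) * p) [ d#0 ]
        * (1# + fromℕ 2 * i - i * i) ≈ 1# - fromℕ 2 * i - i * i
    quotient≈ d#0 = trans (*-congˡ (sym denominator≈)) (trans
      (modulo (i * i * n) (inv-inverseʳ d d#0) (solve 4 (λ i n d e →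
        n :* e :* (i :* i :* d) := i :* i :* n :+ i :* i :* n :* (d :* e :- con (1 , 0)))
        refl i n d (inv d d#0)))
      numerator≈)
      where
      n d : Carrier
      n = - fromℕ 2 + (l - fromℕ 2) * p
      d = - fromℕ 2 + (l + fromℕ 2) * p

    -- Here 2 - i = i(2p - 1). Positivity of 1 + 2i - i² requires i < 1 + √2; the bound 2 suffices
    -- and also covers k = 0, where i = 1.
    inverse<2 : 0# < i → 1# < p + p → i < fromℕ 2
    inverse<2 0<i 1<2p = <-from (*-pos 0<i (0<y-x 1<2p))
      (modulo (- fromℕ 2) pi≈1 (solve 2 (λ p i → con (2 , 0) :- i
        := i :* ((p :+ p) :- con (1 , 0)) :+ (:- con (2 , 0)) :* (p :* i :- con (1 , 0))) refl p i))

mainTheorem5 :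
    ∀ {c ℓ₁ ℓ₂ ℓ₃} (ℝ : RealNumbers c ℓ₁ ℓ₂ ℓ₃) →
    let open RealNumbers ℝ
        open RealAnalysis ℝ
    in
    (π : Carrier) → IsPi π →
    (arctan : Carrier → Carrier) → IsArctan π arctan →
    (k : ℕ) →
    π /ℕ 4 ≈
      fromℕ 2 * arctan (1# / φ ^ (2 ℕ.* k) [ φ^#0 (2 ℕ.* k) ])
      + arctan ((- fromℕ 2 + (fromℕ (L (2 ℕ.* k)) - fromℕ 2) * φ ^ (2 ℕ.* k))
                / (- fromℕ 2 + (fromℕ (L (2 ℕ.* k)) + fromℕ 2) * φ ^ (2 ℕ.* k))
                [ denominator#0 k ])
mainTheorem5 ℝ π (0<π , sinπ≈0 , sin#0) arctan isArctan k =
  arctan-identity 0<π sinπ≈0 sin#0 (isArctan i) (isArctan r) 0<i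
    (inverse<2 pi≈1 lp≈ 0<i (1<2φ^ (2 ℕ.* k)))
    (quotient≈ pi≈1 lp≈ (denominator#0 k))
  where
  open RealNumbers ℝ
  open RealAnalysis ℝ
  open Trigonometry ℝ
  open SumsOfSeries cos sin
    (λ x → proj₂ (complete (partialSum (cosTerm x)) (cos-cauchy x)))
    (λ x → proj₂ (complete (partialSum (sinTerm x)) (sin-cauchy x)))
  open Binet φ φ²≈φ+1
  p i r : Carrier
  p = φ ^ (2 ℕ.* k)
  i = 1# / p [ φ^#0 (2 ℕ.* k) ]
  r = (- fromℕ 2 + (fromℕ (L (2 ℕ.* k)) - fromℕ 2) * p)
    / (- fromℕ 2 + (fromℕ (L (2 ℕ.* k)) + fromℕ 2) * p) [ denominator#0 k ]
  0<i : 0# < i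
  0<i = *-pos 0<1 (inv-pos (φ^#0 (2 ℕ.* k)) (0<φ^ (2 ℕ.* k)))
  pi≈1 : p * i ≈ 1#
  pi≈1 = trans (*-congˡ (*-identityˡ _)) (inv-inverseʳ p (φ^#0 (2 ℕ.* k)))
  lp≈ : fromℕ (L (2 ℕ.* k)) * p ≈ p * p + 1#
  lp≈ = lucas-even k
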